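{- Let $p$ be prime, $m,t\ge1$, $d=t(p-1)$, and let $T$ be Kuhn's triangulation of $R_{p,m}^d$. Let $\lambda:R_{p,m}^d\to R_{p,t}\setminus\{0\}$ be any labeling satisfying $\lambda(\theta x)=\theta\lambda(x)$ for all $x\in\partial R_{p,m}^d$. Then there exist a $(p-1)$-simplex $\{x_1,\dots,x_p\}$ of $T$ and $j\in[t]$ such that $\lambda(x_i)=*^ij$ for all $i\in[p]$.
   Context: For $m\ge1$, $R_{p,m}=\{0\}\cup\{*^ij:i\in\mathbb{Z}_p,j\in[m]\}$ (a "$p$-star": $p$ rays of length $m$ from $0$, the symbols $*^1,\dots,*^p$ being $p$ distinct signs, indices in $[p]$ identified with $\mathbb{Z}_p$), with convention $*^i0=0$. The action is $\theta(*^ij)=*^{i+1}j$, $\theta(0)=0$, extended coordinatewise to $R_{p,m}^d=(R_{p,m})^d$. The boundary $\partial R_{p,m}^d$ is the set of points having at least one coordinate of the form $*^im$. Triangulation: $R_{p,m}^d$ is subdivided into the hypercubes $\{*^{i_1}(a_1-1),*^{i_1}a_1\}\times\dots\times\{*^{i_d}(a_d-1),*^{i_d}a_d\}$ for $a_\ell\in[m]$, $i_\ell\in\mathbb{Z}_p$; each such hypercube (identified with a unit cube via the magnitudes, base point the vertex with all magnitudes $a_\ell-1$) is triangulated by Kuhn's triangulation: for each permutation $\pi$ of $[d]$, the simplex $\{y^0,\dots,y^d\}$ where $y^0$ is the base point and $y^k$ is obtained from $y^{k-1}$ by increasing the magnitude of coordinate $\pi(k)$ by $1$ (along its ray), together with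 all faces. -}

module Defs where

open import Data.Nat using (ℕ; zero; suc; _<_; _<ᵇ_)
open import Data.Nat.DivMod using (_mod_)
open import Data.Fin using (Fin; zero; suc; toℕ; inject₁)
open import Data.Fin.Permutation using (Permutation′; _⟨$⟩ˡ_)
open import Data.Vec using (Vec; map; tabulate; lookup)
open import Data.Product using (_×_; _,_; Σ; ∃)
open import Data.Empty using (⊥)
open import Data.Bool using (Bool; true; false; if_then_else_)
open import Relation.Binary.PropositionalEquality using (_≡_)

-- The p-star R_{p,m}: `origin` is 0, `ray i j` is *^i (toℕ j + 1),
-- so magnitudes 1..m are encoded by Fin m (shifted by one).
data R (p m : ℕ) : Set where
  origin : R p m
  ray    : Fin p → Fin m → R p m

sucMod : ∀ {p} → Fin p → Fin p
sucMod {suc n} i = suc (toℕ i) mod (suc n)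

θ : ∀ {p m} → R p m → R p m
θ origin    = origin
θ (ray i j) = ray (sucMod i) j

Pt : ℕ → ℕ → ℕ → Set
Pt p m d = Vec (R p m) d

θᵈ : ∀ {p m d} → Pt p m d → Pt p m d
θᵈ = map θ

IsMax : ∀ {p m} → R p m → Set
IsMax origin          = ⊥
IsMax {m = m} (ray i j) = suc (toℕ j) ≡ m

Boundary : ∀ {p m d} → Pt p m d → Set
Boundary {d = d} x = ∃ λ (ℓ : Fin d) → IsMax (lookup x ℓ)

-- labels in R_{p,t} ∖ {0}: (i , j) stands for *^i (toℕ j + 1)
Label : ℕ → ℕ → Set
Label p t = Fin p × Fin t

θL : ∀ {p t} → Label p t → Label p t
θL (i , j) = (sucMod i , j)

-- point *^i (a-1) of the ray i, where b = a-1 ∈ {0..m-1} is encoded by Fin m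
lowerPt : ∀ {p m} → Fin p → Fin m → R p m
lowerPt i zero    = origin
lowerPt i (suc b) = ray i (inject₁ b)

-- Kuhn vertex y^k of the hypercube with signs s, base magnitudes a_ℓ - 1 = b ℓ,
-- and permutation π : position of ℓ in the order is π⁻¹(ℓ) (0-based);
-- coordinate ℓ is increased iff π⁻¹(ℓ) < k.
kuhnVertex : ∀ {p m d} → (Fin d → Fin p) → (Fin d → Fin m) → Permutation′ d
           → Fin (suc d) → Pt p m d
kuhnVertex s b π k =
  tabulate λ ℓ → if toℕ (π ⟨$⟩ˡ ℓ) <ᵇ toℕ k then ray (s ℓ) (b ℓ) else lowerPt (s ℓ) (b ℓ)

IsKuhnFace : ∀ {p m d n} → (Fin n → Pt p m d) → Set
IsKuhnFace {p} {m} {d} {n} x =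
  Σ (Fin d → Fin p) λ s → Σ (Fin d → Fin m) λ b → Σ (Permutation′ d) λ π →
  Σ (Fin n → Fin (suc d)) λ k → ∀ i → x i ≡ kuhnVertex s b π (k i)

{-# OPTIONS --safe #-}
module Submission where

-- Suppose that no simplex carries all p signs of one magnitude. Then the labels of every simplex span
-- a simplex of the t-fold join K of boundaries of (p-1)-simplices, which has dimension t(p-1) - 1 and a
-- free ℤ/p-action. As in the standard proof of Dold's theorem, freeness gives alternating cochains φ n
-- on K, φ 0 = 1 in degree -1, with 𝔸 n (φ (n+1)) = δ (φ n) modulo p, where 𝔸 n is alternately the norm
-- of the group ring and θ - 1. On the other side, products with a ray and the same operators 𝔸 n give
-- relative d-cycles D d of (R^d, ∂R^d) whose boundary is 𝔸 of a chain in ∂R^d, where the labeling is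
-- equivariant. Hence the value of δ (φ d) on the image of D d does not depend on d and is 1; but for
-- d = t(p-1) it is 0, because d + 1 labels from K cannot be distinct.

open import Defs
open import Data.Nat using (ℕ; _*_; _∸_; _≤_)
open import Data.Nat.Primality using (Prime)
open import Data.Fin using (Fin)
open import Data.Product using (_×_; _,_; Σ; ∃)
open import Relation.Binary.PropositionalEquality using (_≡_)

open import Data.Bool as Bool using (Bool; true; false; if_then_else_; f≤t; b≤b)
import Data.Bool.Properties as Bool
open import Data.Fin as Fin using (zero; suc; toℕ; fromℕ; inject₁)
open import Data.Fin.Permutation as Permutation using (Permutation′; _⟨$⟩ʳ_)
import Data.Fin.Properties as Fin
open import Data.Integer as ℤ using (ℤ; +_; 0ℤ; 1ℤ; _+_; _-_; -_)
open import Data.Integer.Divisibility.Signed as ℤ∣ using () renaming (_∣_ to _∣ℤ_)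
import Data.Integer.Properties as ℤ
open import Data.Integer.Tactic.RingSolver using (solve-∀)
open import Data.Nat as ℕ using (zero; suc; _<ᵇ_)
import Data.Nat.Coprimality as Coprimality
open import Data.Nat.Divisibility using (∣1⇒≡1)
open import Data.Nat.DivMod as ℕ using (_%_)
open import Data.Nat.GCD using (module Bézout)
open import Data.Nat.GeneralisedArithmetic using (iterate)
open import Data.Nat.Primality using (¬prime[0]; ¬prime[1])
import Data.Nat.Properties as ℕ
open import Data.Product using (∃₂; proj₁; proj₂)
open import Data.Product.Properties using (≡-dec)
open import Data.Sum as Sum using (_⊎_; inj₁; inj₂)
open import Data.Unit using (⊤; tt)
open import Data.Vec using (Vec; []; _∷_; map; lookup; zipWith; tabulate)
import Data.Vec.Membership.DecPropositional as DecMembership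
open import Data.Vec.Membership.Propositional using (_∈_; find)
open import Data.Vec.Membership.Propositional.Properties using (∈-map⁺; ∈-lookup)
import Data.Vec.Properties as Vec
open import Data.Vec.Relation.Binary.Pointwise.Inductive as Pointwise using (Pointwise; []; _∷_)
open import Data.Vec.Relation.Unary.Any using (here; there)
import Data.Vec.Relation.Unary.Any.Properties as Any
open import Function using (_∘_; mk⇔)
open import Level using (0ℓ)
open import Relation.Binary using (Setoid)
open import Relation.Binary.PropositionalEquality
  using (_≢_; _≗_; refl; sym; trans; cong; cong₂; subst; subst₂; module ≡-Reasoning)
import Relation.Binary.Reasoning.Setoid as SetoidReasoning
open import Relation.Nullary using (Dec; yes; no; does; ¬_; contradiction)
open import Relation.Nullary.Decidable using (_×-dec_; does-⇔; dec-true; dec-false)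

open import Algebra.Properties.Semiring.Sum ℤ.+-*-semiring
  using (sum; sum-cong-≗; *-distribˡ-sum; *-distribʳ-sum; ∑-distrib-+)

private variable
  X Y : Set
  n d : ℕ

-- Finite sums

sum-sub : ∀ n (f g : Fin n → ℤ) → sum (λ i → f i - g i) ≡ sum f - sum g
sum-sub zero    f g = refl
sum-sub (suc n) f g = trans (cong (_+_ (f zero - g zero)) (sum-sub n (f ∘ suc) (g ∘ suc)))
  (rearrange (f zero) (g zero) (sum (f ∘ suc)) (sum (g ∘ suc)))
  where
  rearrange : ∀ a b c d → (a - b) + (c - d) ≡ (a + c) - (b + d)
  rearrange = solve-∀

sum-telescope : ∀ n (H : Fin (suc n) → ℤ) →
  sum (λ i → H (suc i) - H (inject₁ i)) ≡ H (fromℕ n) - H zero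
sum-telescope zero    H = sym (ℤ.+-inverseʳ (H zero))
sum-telescope (suc n) H = trans
  (cong (_+_ (H (suc zero) - H zero)) (sum-telescope n (H ∘ suc)))
  (rearrange (H (suc zero)) (H zero) (H (suc (fromℕ n))))
  where
  rearrange : ∀ a b c → (a - b) + (c - a) ≡ c - b
  rearrange = solve-∀

sum-telescope-ℕ : ∀ n (H : ℕ → ℤ) → sum {n} (λ i → H (suc (toℕ i)) - H (toℕ i)) ≡ H n - H 0
sum-telescope-ℕ n H = begin
  sum {n} (λ i → H (suc (toℕ i)) - H (toℕ i))
    ≡⟨ sum-cong-≗ {n} (λ i → cong (λ k → H (suc (toℕ i)) - H k) (Fin.toℕ-inject₁ i)) ⟨
  sum {n} (λ i → H (suc (toℕ i)) - H (toℕ (inject₁ i)))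
    ≡⟨ sum-telescope n (H ∘ toℕ) ⟩
  H (toℕ (fromℕ n)) - H 0
    ≡⟨ cong (λ k → H k - H 0) (Fin.toℕ-fromℕ n) ⟩
  H n - H 0 ∎
  where open ≡-Reasoning

sum-const : ∀ n c → sum {n} (λ _ → c) ≡ + n ℤ.* c
sum-const zero    c = sym (ℤ.*-zeroˡ c)
sum-const (suc n) c = trans (cong (_+_ c) (sum-const n c)) (sym (ℤ.suc-* (+ n) c))

-- Abel summation: `a + s′ k` is `s (suc k)`, so the left side telescopes. In `𝕊-section`, `s` and
-- `s′` are partial sums along an orbit and along the same orbit shifted by one step.
sum-by-parts : ∀ n a (w s s′ : ℕ → ℤ) → s 0 ≡ 0ℤ → (∀ k → s (suc k) ≡ a + s′ k) →
  (a ℤ.* sum {n} (λ k → w (suc (toℕ k))) + sum {n} (λ k → w (suc (toℕ k)) ℤ.* s′ (toℕ k)))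
    - sum {n} (λ k → w (toℕ k) ℤ.* s (toℕ k)) ≡ w n ℤ.* s n
sum-by-parts n a w s s′ s-zero s-suc = begin
  (a ℤ.* sum {n} w₁ + sum {n} (λ k → w₁ k ℤ.* s′ (toℕ k))) - sum {n} (H ∘ toℕ)
    ≡⟨ cong (λ z → (z + sum {n} (λ k → w₁ k ℤ.* s′ (toℕ k))) - sum {n} (H ∘ toℕ)) (*-distribˡ-sum {n} a w₁) ⟩
  (sum {n} (λ k → a ℤ.* w₁ k) + sum {n} (λ k → w₁ k ℤ.* s′ (toℕ k))) - sum {n} (H ∘ toℕ)
    ≡⟨ cong (λ z → z - sum {n} (H ∘ toℕ)) (∑-distrib-+ {n} (λ k → a ℤ.* w₁ k) (λ k → w₁ k ℤ.* s′ (toℕ k))) ⟨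
  sum {n} (λ k → a ℤ.* w₁ k + w₁ k ℤ.* s′ (toℕ k)) - sum {n} (H ∘ toℕ)
    ≡⟨ cong (λ z → z - sum {n} (H ∘ toℕ)) (sum-cong-≗ {n} H-suc) ⟩
  sum {n} (λ k → H (suc (toℕ k))) - sum {n} (H ∘ toℕ)
    ≡⟨ sum-sub n (λ k → H (suc (toℕ k))) (H ∘ toℕ) ⟨
  sum {n} (λ k → H (suc (toℕ k)) - H (toℕ k))
    ≡⟨ sum-telescope-ℕ n H ⟩
  w n ℤ.* s n - w 0 ℤ.* s 0
    ≡⟨ cong (λ z → w n ℤ.* s n - w 0 ℤ.* z) s-zero ⟩
  w n ℤ.* s n - w 0 ℤ.* 0ℤ
    ≡⟨ drop (w n ℤ.* s n) (w 0) ⟩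
  w n ℤ.* s n ∎
  where
  open ≡-Reasoning
  H : ℕ → ℤ
  H k = w k ℤ.* s k
  w₁ : Fin n → ℤ
  w₁ k = w (suc (toℕ k))
  factor : ∀ a b c → a ℤ.* b + b ℤ.* c ≡ b ℤ.* (a + c)
  factor = solve-∀
  H-suc : ∀ k → a ℤ.* w₁ k + w₁ k ℤ.* s′ (toℕ k) ≡ H (suc (toℕ k))
  H-suc k = trans (factor a (w₁ k) (s′ (toℕ k))) (cong (ℤ._*_ (w₁ k)) (sym (s-suc (toℕ k))))
  drop : ∀ a b → a - b ℤ.* 0ℤ ≡ a
  drop = solve-∀

-- Iteration

iterate-comm : (h : X → X) → ∀ k x → iterate h (h x) k ≡ h (iterate h x k)
iterate-comm h zero    x = refl
iterate-comm h (suc k) x = iterate-comm h k (h x)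

iterate-natural : {h : X → X} {h′ : Y → Y} (u : X → Y) → (∀ x → u (h x) ≡ h′ (u x)) →
  ∀ k x → u (iterate h x k) ≡ iterate h′ (u x) k
iterate-natural u nat zero    x = refl
iterate-natural {h = h} {h′ = h′} u nat (suc k) x =
  trans (iterate-natural u nat k (h x)) (cong (λ y → iterate h′ y k) (nat x))

iterate-map : (h : X → X) → ∀ k (σ : Vec X n) → iterate (map h) σ k ≡ map (λ x → iterate h x k) σ
iterate-map h zero    σ = sym (Vec.map-id σ)
iterate-map h (suc k) σ = trans (iterate-map h k (map h σ)) (sym (Vec.map-∘ _ h σ))

-- Functions on Vec X k are cochains of degree k - 1; the complex is augmented, k = 0 being allowed.

δ : (Vec X n → ℤ) → Vec X (suc n) → ℤ
δ {n = zero}  f (x ∷ []) = f []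
δ {n = suc n} f (x ∷ xs) = f xs - δ (f ∘ (x ∷_)) xs

δ-cong : {f g : Vec X n → ℤ} → f ≗ g → δ f ≗ δ g
δ-cong {n = zero}  eq (x ∷ []) = eq []
δ-cong {n = suc n} eq (x ∷ xs) = cong₂ _-_ (eq xs) (δ-cong (eq ∘ (x ∷_)) xs)

δ-sub : (f g : Vec X n → ℤ) → ∀ σ → δ (λ τ → f τ - g τ) σ ≡ δ f σ - δ g σ
δ-sub {n = zero}  f g (x ∷ []) = refl
δ-sub {n = suc n} f g (x ∷ xs) =
  trans (cong (_-_ (f xs - g xs)) (δ-sub (f ∘ (x ∷_)) (g ∘ (x ∷_)) xs))
        (rearrange (f xs) (g xs) (δ (f ∘ (x ∷_)) xs) (δ (g ∘ (x ∷_)) xs))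
  where
  rearrange : ∀ a b c d → (a - b) - (c - d) ≡ (a - c) - (b - d)
  rearrange = solve-∀

δ-neg : (f : Vec X n → ℤ) → ∀ σ → δ (λ τ → - f τ) σ ≡ - δ f σ
δ-neg {n = zero}  f (x ∷ []) = refl
δ-neg {n = suc n} f (x ∷ xs) =
  trans (cong (_-_ (- f xs)) (δ-neg (f ∘ (x ∷_)) xs))
        (sym (ℤ.neg-distrib-+ (f xs) (- δ (f ∘ (x ∷_)) xs)))

δ-sum : ∀ {m} (f : Fin m → Vec X n → ℤ) → ∀ σ → δ (λ τ → sum (λ i → f i τ)) σ ≡ sum (λ i → δ (f i) σ)
δ-sum {n = zero}  f (x ∷ []) = refl
δ-sum {n = suc n} {m} f (x ∷ xs) =
  trans (cong (_-_ (sum (λ i → f i xs))) (δ-sum (λ i → f i ∘ (x ∷_)) xs))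
        (sym (sum-sub m (λ i → f i xs) (λ i → δ (f i ∘ (x ∷_)) xs)))

δ-map : (h : X → Y) (f : Vec Y n → ℤ) → ∀ σ → δ (f ∘ map h) σ ≡ δ f (map h σ)
δ-map {n = zero}  h f (x ∷ []) = refl
δ-map {n = suc n} h f (x ∷ xs) = cong (_-_ (f (map h xs))) (δ-map h (f ∘ (h x ∷_)) xs)

δ∘δ : (f : Vec X n → ℤ) → ∀ σ → δ (δ f) σ ≡ 0ℤ
δ∘δ {n = zero}  f (x ∷ y ∷ []) = ℤ.+-inverseʳ (f [])
δ∘δ {n = suc n} f (x ∷ xs@(_ ∷ _)) = begin
  δ f xs - δ (λ τ → f τ - δ (f ∘ (x ∷_)) τ) xs      ≡⟨ cong (_-_ (δ f xs)) (δ-sub f (δ (f ∘ (x ∷_))) xs) ⟩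
  δ f xs - (δ f xs - δ (δ (f ∘ (x ∷_))) xs)        ≡⟨ cong (λ z → δ f xs - (δ f xs - z)) (δ∘δ (f ∘ (x ∷_)) xs) ⟩
  δ f xs - (δ f xs - 0ℤ)                           ≡⟨ cancel (δ f xs) ⟩
  0ℤ ∎
  where
  open ≡-Reasoning
  cancel : ∀ a → a - (a - 0ℤ) ≡ 0ℤ
  cancel = solve-∀

-- f evaluated on the prism Σᵢ ± (U x₀, …, U xᵢ, V xᵢ, …, V xₖ) over the simplex (x₀, …, xₖ).

prism : (U V : X → Y) → (Vec Y (suc n) → ℤ) → Vec X n → ℤ
prism U V f []       = 0ℤ
prism U V f (x ∷ xs) = f (U x ∷ V x ∷ map V xs) - prism U V (f ∘ (U x ∷_)) xs

prism-sub : (U V : X → Y) (f g : Vec Y (suc n) → ℤ) →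
  ∀ σ → prism U V (λ τ → f τ - g τ) σ ≡ prism U V f σ - prism U V g σ
prism-sub U V f g []       = refl
prism-sub U V f g (x ∷ xs) =
  trans (cong (_-_ (f (U x ∷ V x ∷ map V xs) - g (U x ∷ V x ∷ map V xs)))
          (prism-sub U V (f ∘ (U x ∷_)) (g ∘ (U x ∷_)) xs))
        (rearrange (f (U x ∷ V x ∷ map V xs)) (g (U x ∷ V x ∷ map V xs))
          (prism U V (f ∘ (U x ∷_)) xs) (prism U V (g ∘ (U x ∷_)) xs))
  where
  rearrange : ∀ a b c d → (a - b) - (c - d) ≡ (a - c) - (b - d)
  rearrange = solve-∀

-- The prism is a chain homotopy between the maps induced by `U` and `V`. In the induction on the
-- first vertex the terms `fUV`, coming from the wall between neighbouring pieces, cancel.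
prism-δ : (U V : X → Y) (f : Vec Y (suc n) → ℤ) → ∀ σ →
  prism U V (δ f) σ ≡ (f (map V σ) - f (map U σ)) - δ (prism U V f) σ
prism-δ {n = zero} U V f (x ∷ []) = refl
prism-δ {n = suc n} U V f (x ∷ xs@(_ ∷ _)) = begin
  (fV - (fUV - dd)) - prism U V (λ τ → f τ - δ (f ∘ (U x ∷_)) τ) xs
    ≡⟨ cong (_-_ (fV - (fUV - dd))) (prism-sub U V f (δ (f ∘ (U x ∷_))) xs) ⟩
  (fV - (fUV - dd)) - (prism U V f xs - prism U V (δ (f ∘ (U x ∷_))) xs)
    ≡⟨ cong (λ z → (fV - (fUV - dd)) - (prism U V f xs - z)) (prism-δ U V (f ∘ (U x ∷_)) xs) ⟩
  (fV - (fUV - dd)) - (prism U V f xs - ((fUV - fU) - dp))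
    ≡⟨ rearrange fV fUV dd (prism U V f xs) fU dp ⟩
  (fV - fU) - (prism U V f xs - (dd - dp))
    ≡⟨ cong (λ z → (fV - fU) - (prism U V f xs - z)) (cong (λ w → w - dp) (δ-map V (λ τ → f (U x ∷ V x ∷ τ)) xs)) ⟨
  (fV - fU) - (prism U V f xs - (δ (λ τ → f (U x ∷ V x ∷ map V τ)) xs - dp))
    ≡⟨ cong (λ z → (fV - fU) - (prism U V f xs - z)) (δ-sub (λ τ → f (U x ∷ V x ∷ map V τ)) (prism U V (f ∘ (U x ∷_))) xs) ⟨
  (fV - fU) - (prism U V f xs - δ (λ τ → prism U V f (x ∷ τ)) xs) ∎
  where
  open ≡-Reasoning
  fV  = f (V x ∷ map V xs)
  fUV = f (U x ∷ map V xs)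
  fU  = f (U x ∷ map U xs)
  dd  = δ (λ τ → f (U x ∷ V x ∷ τ)) (map V xs)
  dp  = δ (prism U V (f ∘ (U x ∷_))) xs
  rearrange : ∀ a b c p d e → (a - (b - c)) - (p - ((b - d) - e)) ≡ (a - d) - (p - (c - e))
  rearrange = solve-∀

-- Alternating cochains

data Swap {X : Set} : ∀ {n} → Vec X n → Vec X n → Set where
  here  : ∀ {n x y} {zs : Vec X n} → Swap (x ∷ y ∷ zs) (y ∷ x ∷ zs)
  there : ∀ {n x} {xs ys : Vec X n} → Swap xs ys → Swap (x ∷ xs) (x ∷ ys)

data Stutter {X : Set} : ∀ {n} → Vec X n → Set where
  here  : ∀ {n x} {zs : Vec X n} → Stutter (x ∷ x ∷ zs)
  there : ∀ {n x} {xs : Vec X n} → Stutter xs → Stutter (x ∷ xs)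

-- Adjacent transpositions and repetitions are used because they pass through the recursion of `δ`,
-- which peels off the first vertex.
record Alternating {X : Set} {n} (f : Vec X n → ℤ) : Set where
  field
    swap    : ∀ {σ τ} → Swap σ τ → f σ ≡ - f τ
    stutter : ∀ {σ} → Stutter σ → f σ ≡ 0ℤ

open Alternating

Swap-map : (h : X → Y) {σ τ : Vec X n} → Swap σ τ → Swap (map h σ) (map h τ)
Swap-map h here      = here
Swap-map h (there s) = there (Swap-map h s)

Stutter-map : (h : X → Y) {σ : Vec X n} → Stutter σ → Stutter (map h σ)
Stutter-map h here      = here
Stutter-map h (there s) = there (Stutter-map h s)

Swap-sym : {σ τ : Vec X n} → Swap σ τ → Swap τ σ
Swap-sym here      = here
Swap-sym (there s) = there (Swap-sym s)

Alternating-∷ : ∀ {f : Vec X (suc n) → ℤ} x → Alternating f → Alternating (f ∘ (x ∷_))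
Alternating-∷ x alt .swap s    = alt .swap (there s)
Alternating-∷ x alt .stutter s = alt .stutter (there s)

-- The two terms that delete one of the adjacent entries trade places with opposite signs under a
-- swap, and cancel if the entries agree. Every other term still contains the pair.
δ-alternating : {f : Vec X n → ℤ} → Alternating f → Alternating (δ f)
δ-alternating {n = zero} {f} alt .swap (there ())
δ-alternating {n = zero} {f} alt .stutter (there ())
δ-alternating {n = suc zero} {f} alt .swap (here {x = x} {y} {[]}) = rearrange (f (y ∷ [])) (f (x ∷ []))
  where
  rearrange : ∀ a b → a - b ≡ - (b - a)
  rearrange = solve-∀
δ-alternating {n = suc (suc n)} {f} alt .swap (here {x = x} {y} {zs}) = begin
  f (y ∷ zs) - (f (x ∷ zs) - δ (λ τ → f (x ∷ y ∷ τ)) zs)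
    ≡⟨ cong (λ z → f (y ∷ zs) - (f (x ∷ zs) - z)) (δ-cong (λ τ → alt .swap here) zs) ⟩
  f (y ∷ zs) - (f (x ∷ zs) - δ (λ τ → - f (y ∷ x ∷ τ)) zs)
    ≡⟨ cong (λ z → f (y ∷ zs) - (f (x ∷ zs) - z)) (δ-neg (λ τ → f (y ∷ x ∷ τ)) zs) ⟩
  f (y ∷ zs) - (f (x ∷ zs) - - δ (λ τ → f (y ∷ x ∷ τ)) zs)
    ≡⟨ rearrange (f (y ∷ zs)) (f (x ∷ zs)) (δ (λ τ → f (y ∷ x ∷ τ)) zs) ⟩
  - (f (x ∷ zs) - (f (y ∷ zs) - δ (λ τ → f (y ∷ x ∷ τ)) zs)) ∎
  where
  open ≡-Reasoning
  rearrange : ∀ a b c → a - (b - - c) ≡ - (b - (a - c))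
  rearrange = solve-∀
δ-alternating {n = suc n} {f} alt .swap (there {x = x} {xs} {ys} s) =
  trans (cong₂ _-_ (alt .swap s) (δ-alternating (Alternating-∷ x alt) .swap s))
        (sym (ℤ.neg-distrib-+ (f ys) (- δ (f ∘ (x ∷_)) ys)))
δ-alternating {n = suc zero} {f} alt .stutter (here {x = x} {[]}) = ℤ.+-inverseʳ (f (x ∷ []))
δ-alternating {n = suc (suc n)} {f} alt .stutter (here {x = x} {zs}) = begin
  f (x ∷ zs) - (f (x ∷ zs) - δ (λ τ → f (x ∷ x ∷ τ)) zs)
    ≡⟨ cong (λ z → f (x ∷ zs) - (f (x ∷ zs) - z)) (δ-cong (λ τ → trans (alt .stutter here) (sym (ℤ.+-inverseʳ 0ℤ))) zs) ⟩
  f (x ∷ zs) - (f (x ∷ zs) - δ (λ τ → 0ℤ - 0ℤ) zs)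
    ≡⟨ cong (λ z → f (x ∷ zs) - (f (x ∷ zs) - z)) (δ-sub (λ _ → 0ℤ) (λ _ → 0ℤ) zs) ⟩
  f (x ∷ zs) - (f (x ∷ zs) - (δ (λ τ → 0ℤ) zs - δ (λ τ → 0ℤ) zs))
    ≡⟨ rearrange (f (x ∷ zs)) (δ (λ τ → 0ℤ) zs) ⟩
  0ℤ ∎
  where
  open ≡-Reasoning
  rearrange : ∀ a b → a - (a - (b - b)) ≡ 0ℤ
  rearrange = solve-∀
δ-alternating {n = suc n} {f} alt .stutter (there {x = x} {xs} s) =
  cong₂ _-_ (alt .stutter s) (δ-alternating (Alternating-∷ x alt) .stutter s)

-- Transpositions move the earlier of the two equal entries to the right until it is next to the
-- later one.
alternating-repeat : {f : Vec X n → ℤ} → Alternating f → ∀ σ {i j} → i Fin.< j →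
  lookup σ i ≡ lookup σ j → f σ ≡ 0ℤ
alternating-repeat alt (x ∷ xs) {suc i} {suc j} i<j eq =
  alternating-repeat (Alternating-∷ x alt) xs (ℕ.s<s⁻¹ i<j) eq
alternating-repeat alt (x ∷ .x ∷ xs) {zero} {suc zero} i<j refl = alt .stutter here
alternating-repeat alt (x ∷ y ∷ xs) {zero} {suc (suc j)} i<j eq =
  trans (alt .swap here)
        (cong -_ (alternating-repeat (Alternating-∷ y alt) (x ∷ xs) {zero} {suc j} ℕ.z<s eq))

sum-neg : ∀ n (f : Fin n → ℤ) → sum (λ i → - f i) ≡ - sum f
sum-neg zero    f = refl
sum-neg (suc n) f = trans (cong (_+_ (- f zero)) (sum-neg n (f ∘ suc)))
                          (sym (ℤ.neg-distrib-+ (f zero) (sum (f ∘ suc))))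

sum-zero : ∀ n {f : Fin n → ℤ} → (∀ i → f i ≡ 0ℤ) → sum f ≡ 0ℤ
sum-zero zero    eq = refl
sum-zero (suc n) eq = cong₂ _+_ (eq zero) (sum-zero n (eq ∘ suc))

*-alternating : {w f : Vec X n → ℤ} → (∀ {σ τ} → Swap σ τ → w σ ≡ w τ) → Alternating f →
  Alternating (λ σ → w σ ℤ.* f σ)
*-alternating {w = w} {f} w-sym alt .swap {σ} {τ} s =
  trans (cong₂ ℤ._*_ (w-sym s) (alt .swap s)) (sym (ℤ.neg-distribʳ-* (w τ) (f τ)))
*-alternating {w = w} w-sym alt .stutter {σ} s = trans (cong (ℤ._*_ (w σ)) (alt .stutter s)) (ℤ.*-zeroʳ (w σ))

neg-alternating : {f : Vec X n → ℤ} → Alternating f → Alternating (λ σ → - f σ)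
neg-alternating alt .swap s    = cong -_ (alt .swap s)
neg-alternating alt .stutter s = cong -_ (alt .stutter s)

sum-alternating : ∀ m {f : Fin m → Vec X n → ℤ} → (∀ i → Alternating (f i)) →
  Alternating (λ σ → sum (λ i → f i σ))
sum-alternating m {f} alt .swap {τ = τ} s = trans (sum-cong-≗ (λ i → alt i .swap s)) (sum-neg m (λ i → f i τ))
sum-alternating m alt .stutter s = sum-zero m (λ i → alt i .stutter s)

Swap-iterate : (h : X → X) → ∀ k {σ τ : Vec X n} → Swap σ τ → Swap (iterate (map h) σ k) (iterate (map h) τ k)
Swap-iterate h zero    s = s
Swap-iterate h (suc k) s = Swap-iterate h k (Swap-map h s)

iterate-alternating : (h : X → X) → ∀ k {f : Vec X n → ℤ} → Alternating f → Alternating (λ σ → f (iterate (map h) σ k))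
iterate-alternating h k alt .swap s = alt .swap (Swap-iterate h k s)
iterate-alternating h k alt .stutter s = alt .stutter (Stutter-iterate k s)
  where
  Stutter-iterate : ∀ k {σ} → Stutter σ → Stutter (iterate (map h) σ k)
  Stutter-iterate zero    s = s
  Stutter-iterate (suc k) s = Stutter-iterate k (Stutter-map h s)

-- Indicators and counting.

indicator : Bool → ℤ
indicator b = if b then 1ℤ else 0ℤ

count : ∀ {n} → (Fin n → Bool) → ℕ
count {zero}  b = 0
count {suc n} b = (if b zero then 1 else 0) ℕ.+ count (b ∘ suc)

count-sum : ∀ {n} (b : Fin n → Bool) → + count b ≡ sum (λ k → indicator (b k))
count-sum {zero}  b = refl
count-sum {suc n} b with b zero
... | true  = cong (_+_ 1ℤ) (count-sum (b ∘ suc))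
... | false = trans (count-sum (b ∘ suc)) (sym (ℤ.+-identityˡ _))

count-cong : ∀ {n} {b b′ : Fin n → Bool} → b ≗ b′ → count b ≡ count b′
count-cong {zero}  eq = refl
count-cong {suc n} eq = cong₂ (λ x y → (if x then 1 else 0) ℕ.+ y) (eq zero) (count-cong (eq ∘ suc))

count-≤ : ∀ {n} (b : Fin n → Bool) → count b ≤ n
count-≤ {zero}  b = ℕ.z≤n
count-≤ {suc n} b with b zero
... | true  = ℕ.s≤s (count-≤ (b ∘ suc))
... | false = ℕ.m≤n⇒m≤1+n (count-≤ (b ∘ suc))

count-pos : ∀ {n} (b : Fin n → Bool) k → b k ≡ true → 0 ℕ.< count b
count-pos b zero    eq rewrite eq = ℕ.z<s
count-pos b (suc k) eq = ℕ.<-≤-trans (count-pos (b ∘ suc) k eq) (ℕ.m≤n+m _ (if b zero then 1 else 0))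

count-<⊎all : ∀ {n} (b : Fin n → Bool) → count b ℕ.< n ⊎ (∀ k → b k ≡ true)
count-<⊎all {zero}  b = inj₂ (λ ())
count-<⊎all {suc n} b with b zero in eq
... | false = inj₁ (ℕ.s≤s (count-≤ (b ∘ suc)))
... | true  = Sum.map ℕ.s≤s (λ { all zero → eq ; all (suc k) → all k }) (count-<⊎all (b ∘ suc))

-- Congruence modulo `p` with exceptions, and the periodic resolution.

module Modulo (p : ℕ) where

  infix 4 _≈[_]_

  -- With the desired conclusion as Q, its decidability is not needed.
  data _≈[_]_ (a : ℤ) (Q : Set) (b : ℤ) : Set where
    exceptional : Q → a ≈[ Q ] b
    congruent   : + p ∣ℤ (a - b) → a ≈[ Q ] b

  private variable
    Q Q′ : Set
    a b c c′ : ℤ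

  ≈-reflexive : a ≡ b → a ≈[ Q ] b
  ≈-reflexive {a} refl = congruent (ℤ∣.divides 0ℤ (trans (ℤ.+-inverseʳ a) (sym (ℤ.*-zeroˡ (+ p)))))

  ≈-sym : a ≈[ Q ] b → b ≈[ Q ] a
  ≈-sym (exceptional q) = exceptional q
  ≈-sym {a} {b = b} (congruent e) = congruent (subst (+ p ∣ℤ_) (rearrange a b) (ℤ∣.∣m⇒∣-m e))
    where
    rearrange : ∀ a b → - (a - b) ≡ b - a
    rearrange = solve-∀

  +-cong : a ≈[ Q ] b → c ≈[ Q ] c′ → a + c ≈[ Q ] b + c′
  +-cong (exceptional q) _ = exceptional q
  +-cong (congruent _) (exceptional q) = exceptional q
  +-cong {a} {b = b} {c} {c′} (congruent e) (congruent e′) =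
    congruent (subst (+ p ∣ℤ_) (rearrange a b c c′) (ℤ∣.∣m∣n⇒∣m+n e e′))
    where
    rearrange : ∀ a b c d → (a - b) + (c - d) ≡ (a + c) - (b + d)
    rearrange = solve-∀

  *-congˡ : ∀ c → a ≈[ Q ] b → c ℤ.* a ≈[ Q ] c ℤ.* b
  *-congˡ c (exceptional q) = exceptional q
  *-congˡ {a} {b = b} c (congruent e) = congruent (subst (+ p ∣ℤ_) (rearrange a b c) (ℤ∣.∣n⇒∣m*n c e))
    where
    rearrange : ∀ a b c → c ℤ.* (a - b) ≡ c ℤ.* a - c ℤ.* b
    rearrange = solve-∀

  neg-cong : a ≈[ Q ] b → - a ≈[ Q ] - b
  neg-cong (exceptional q) = exceptional q
  neg-cong {a} {b = b} (congruent e) = congruent (subst (+ p ∣ℤ_) (ℤ.neg-distrib-+ a (- b)) (ℤ∣.∣m⇒∣-m e))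

  sub-cong : a ≈[ Q ] b → c ≈[ Q ] c′ → a - c ≈[ Q ] b - c′
  sub-cong e e′ = +-cong e (neg-cong e′)

  ≈-trans : a ≈[ Q ] b → b ≈[ Q ] c → a ≈[ Q ] c
  ≈-trans (exceptional q) _ = exceptional q
  ≈-trans (congruent _) (exceptional q) = exceptional q
  ≈-trans {a} {b = b} {c} (congruent e) (congruent e′) =
    congruent (subst (+ p ∣ℤ_) (rearrange a b c) (ℤ∣.∣m∣n⇒∣m+n e e′))
    where
    rearrange : ∀ a b c → (a - b) + (b - c) ≡ a - c
    rearrange = solve-∀

  ≈-weaken : (Q → Q′) → a ≈[ Q ] b → a ≈[ Q′ ] b
  ≈-weaken i (exceptional q) = exceptional (i q)
  ≈-weaken i (congruent e)   = congruent e

  p*≈0 : ∀ c → + p ℤ.* c ≈[ Q ] 0ℤ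
  p*≈0 c = congruent (ℤ∣.divides c (trans (ℤ.+-identityʳ (+ p ℤ.* c)) (ℤ.*-comm (+ p) c)))

  sum-cong : ∀ n {f g : Fin n → ℤ} → (∀ i → f i ≈[ Q ] g i) → sum f ≈[ Q ] sum g
  sum-cong zero    eq = ≈-reflexive refl
  sum-cong (suc n) eq = +-cong (eq zero) (sum-cong n (eq ∘ suc))

  ≈-setoid : Set → Setoid 0ℓ 0ℓ
  ≈-setoid Q = record
    { Carrier = ℤ
    ; _≈_ = _≈[ Q ]_
    ; isEquivalence = record { refl = ≈-reflexive refl ; sym = ≈-sym ; trans = ≈-trans }
    }

  module ≈-Reasoning (Q : Set) = SetoidReasoning (≈-setoid Q)

  -- Faces of `σ` have their entries in `σ`, and this inclusion is handed to the hypothesis so that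
  -- an exception at a face, such as `Full τ`, can be turned into one at `σ`.
  δ-≈cong : ∀ {n} {f g : Vec X n → ℤ} (σ : Vec X (suc n)) →
    (∀ τ → (∀ {x} → x ∈ τ → x ∈ σ) → f τ ≈[ Q ] g τ) → δ f σ ≈[ Q ] δ g σ
  δ-≈cong {n = zero}  (x ∷ []) eq = eq [] (λ ())
  δ-≈cong {n = suc n} (x ∷ xs) eq = sub-cong (eq xs there)
    (δ-≈cong xs (λ τ τ⊆xs → eq (x ∷ τ) λ { (here e) → here e ; (there y∈τ) → there (τ⊆xs y∈τ) }))

  -- The differentials of the periodic resolution of ℤ over the group ring of ℤ/p.
  𝔸 : (Y → Y) → ℕ → (Y → ℤ) → Y → ℤ
  𝔸 h 0 f y = sum {p} (λ k → f (iterate h y (toℕ k)))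
  𝔸 h 1 f y = f (h y) - f y
  𝔸 h (suc (suc n)) = 𝔸 h n

  𝔸-cong : (h : Y → Y) → ∀ n {f g : Y → ℤ} y →
    (∀ k → f (iterate h y k) ≈[ Q ] g (iterate h y k)) → 𝔸 h n f y ≈[ Q ] 𝔸 h n g y
  𝔸-cong h 0 y eq = sum-cong p (eq ∘ toℕ)
  𝔸-cong h 1 y eq = sub-cong (eq 1) (eq 0)
  𝔸-cong h (suc (suc n)) = 𝔸-cong h n

  𝔸-sub : (h : Y → Y) → ∀ n (f g : Y → ℤ) y → 𝔸 h n (λ z → f z - g z) y ≡ 𝔸 h n f y - 𝔸 h n g y
  𝔸-sub h 0 f g y = sum-sub p (λ k → f (iterate h y (toℕ k))) (λ k → g (iterate h y (toℕ k)))
  𝔸-sub h 1 f g y = rearrange (f (h y)) (g (h y)) (f y) (g y)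
    where
    rearrange : ∀ a b c d → (a - b) - (c - d) ≡ (a - c) - (b - d)
    rearrange = solve-∀
  𝔸-sub h (suc (suc n)) = 𝔸-sub h n

  -- Commutation is asked for only along the orbit of `x`, since a labeling is equivariant only on
  -- the boundary.
  𝔸-natural : (h : X → X) (h′ : Y → Y) (u : X → Y) (f : Y → ℤ) → ∀ n x →
    (∀ k → u (iterate h x k) ≡ iterate h′ (u x) k) → 𝔸 h n (f ∘ u) x ≡ 𝔸 h′ n f (u x)
  𝔸-natural h h′ u f 0 x eq = sum-cong-≗ {p} (cong f ∘ eq ∘ toℕ)
  𝔸-natural h h′ u f 1 x eq = cong₂ _-_ (cong f (eq 1)) (cong f (eq 0))
  𝔸-natural h h′ u f (suc (suc n)) = 𝔸-natural h h′ u f n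

  orbit-shift : (h : Y → Y) → ∀ (f : Y → ℤ) y → iterate h y p ≡ y →
    sum {p} (λ k → f (iterate h (h y) (toℕ k)) - f (iterate h y (toℕ k))) ≡ 0ℤ
  orbit-shift h f y period =
    trans (sum-telescope-ℕ p (λ k → f (iterate h y k)))
          (trans (cong (λ z → f z - f y) period) (ℤ.+-inverseʳ (f y)))

  -- In either order, the norm and θ - 1 compose to a sum of consecutive differences around a closed
  -- orbit.
  𝔸∘𝔸 : (h : Y → Y) → (∀ y → iterate h y p ≡ y) → ∀ n (f : Y → ℤ) y → 𝔸 h n (𝔸 h (suc n) f) y ≡ 0ℤ
  𝔸∘𝔸 h period 0 f y = trans
    (sum-cong-≗ {p} (λ k → cong (λ z → f z - f (iterate h y (toℕ k))) (sym (iterate-comm h (toℕ k) y))))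
    (orbit-shift h f y (period y))
  𝔸∘𝔸 h period 1 f y = trans
    (sym (sum-sub p (λ k → f (iterate h (h y) (toℕ k))) (λ k → f (iterate h y (toℕ k)))))
    (orbit-shift h f y (period y))
  𝔸∘𝔸 h period (suc (suc n)) = 𝔸∘𝔸 h period n

  δ-iterate : (h : X → X) → ∀ k (f : Vec X n → ℤ) σ →
    δ (λ τ → f (iterate (map h) τ k)) σ ≡ δ f (iterate (map h) σ k)
  δ-iterate h zero    f σ = refl
  δ-iterate h (suc k) f σ = trans (δ-map h (λ τ → f (iterate (map h) τ k)) σ) (δ-iterate h k f (map h σ))

  δ-𝔸 : (h : X → X) → ∀ m (f : Vec X n → ℤ) σ → δ (𝔸 (map h) m f) σ ≡ 𝔸 (map h) m (δ f) σ
  δ-𝔸 h 0 f σ = trans (δ-sum {m = p} (λ k τ → f (iterate (map h) τ (toℕ k))) σ)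
                      (sum-cong-≗ {p} (λ k → δ-iterate h (toℕ k) f σ))
  δ-𝔸 h 1 f σ = trans (δ-sub (f ∘ map h) f σ) (cong (λ z → z - δ f σ) (δ-map h f σ))
  δ-𝔸 h (suc (suc m)) = δ-𝔸 h m

-- Rotations

module _ {p′ : ℕ} where

  private p = suc p′

  %-absorb : ∀ a k → (a % p ℕ.+ k) % p ≡ (a ℕ.+ k) % p
  %-absorb a k = begin
    (a % p ℕ.+ k) % p         ≡⟨ ℕ.%-distribˡ-+ (a % p) k p ⟩
    (a % p % p ℕ.+ k % p) % p ≡⟨ cong (λ z → (z ℕ.+ k % p) % p) (ℕ.m%n%n≡m%n a p) ⟩
    (a % p ℕ.+ k % p) % p     ≡⟨ ℕ.%-distribˡ-+ a k p ⟨
    (a ℕ.+ k) % p ∎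
    where open ≡-Reasoning

  toℕ-iterate-sucMod : ∀ k (i : Fin p) → toℕ (iterate sucMod i k) ≡ (toℕ i ℕ.+ k) % p
  toℕ-iterate-sucMod zero    i = sym (trans (cong (_% p) (ℕ.+-identityʳ (toℕ i))) (ℕ.m<n⇒m%n≡m (Fin.toℕ<n i)))
  toℕ-iterate-sucMod (suc k) i = begin
    toℕ (iterate sucMod (sucMod i) k)  ≡⟨ toℕ-iterate-sucMod k (sucMod i) ⟩
    (toℕ (sucMod i) ℕ.+ k) % p         ≡⟨ cong (λ z → (z ℕ.+ k) % p) (Fin.toℕ-fromℕ< (ℕ.m%n<n (suc (toℕ i)) p)) ⟩
    (suc (toℕ i) % p ℕ.+ k) % p        ≡⟨ %-absorb (suc (toℕ i)) k ⟩
    (suc (toℕ i) ℕ.+ k) % p            ≡⟨ cong (_% p) (ℕ.+-suc (toℕ i) k) ⟨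
    (toℕ i ℕ.+ suc k) % p ∎
    where open ≡-Reasoning

  sucMod-period : (i : Fin p) → iterate sucMod i p ≡ i
  sucMod-period i = Fin.toℕ-injective (trans (toℕ-iterate-sucMod p i)
    (trans (ℕ.[m+n]%n≡m%n (toℕ i) p) (ℕ.m<n⇒m%n≡m (Fin.toℕ<n i))))

  sucMod-from-zero : (i : Fin p) → iterate sucMod zero (toℕ i) ≡ i
  sucMod-from-zero i = Fin.toℕ-injective (trans (toℕ-iterate-sucMod (toℕ i) zero) (ℕ.m<n⇒m%n≡m (Fin.toℕ<n i)))

  sucMod-to-zero : (i : Fin p) → iterate sucMod i (p ∸ toℕ i) ≡ zero
  sucMod-to-zero i = Fin.toℕ-injective (begin
    toℕ (iterate sucMod i (p ∸ toℕ i))   ≡⟨ toℕ-iterate-sucMod (p ∸ toℕ i) i ⟩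
    (toℕ i ℕ.+ (p ∸ toℕ i)) % p          ≡⟨ cong (_% p) (ℕ.m+[n∸m]≡n (ℕ.<⇒≤ (Fin.toℕ<n i))) ⟩
    p % p                                ≡⟨ ℕ.n%n≡0 p ⟩
    0 ∎)
    where open ≡-Reasoning

iterate-map-period : ∀ (h : X → X) {k} → (∀ x → iterate h x k ≡ x) → ∀ (σ : Vec X n) → iterate (map h) σ k ≡ σ
iterate-map-period h {k} period σ = trans (iterate-map h k σ) (trans (Vec.map-cong period σ) (Vec.map-id σ))

-- These are the representatives of the residues invertible modulo a prime `p`.
Unit : ℕ → ℕ → Set
Unit p c = 0 ℕ.< c × c ℕ.< p

iterate-+ : (h : X → X) → ∀ k l x → iterate h (iterate h x k) l ≡ iterate h x (k ℕ.+ l)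
iterate-+ h zero    l x = refl
iterate-+ h (suc k) l x = iterate-+ h k l (h x)

-- Tuples of labels, weights on their orbits, and the contracting homotopy.

module Labels {p′ : ℕ} (p-prime : Prime (suc p′)) {t : ℕ} where

  p : ℕ
  p = suc p′

  open Modulo p public
  open DecMembership {A = Label p t} (≡-dec Fin._≟_ Fin._≟_) using (_∈?_)

  θ̂ : Vec (Label p t) n → Vec (Label p t) n
  θ̂ = map θL

  -- Tuples that are not full span simplices of the join K, so a congruence with exception `Full σ`
  -- is a statement about cochains of K.
  Full : Vec (Label p t) n → Set
  Full σ = ∃ λ j → ∀ i → (i , j) ∈ σ

  iterate-θL : ∀ k (i : Fin p) (j : Fin t) → iterate θL (i , j) k ≡ (iterate sucMod i k , j)
  iterate-θL zero    i j = refl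
  iterate-θL (suc k) i j = iterate-θL k (sucMod i) j

  θ̂-period : (σ : Vec (Label p t) n) → iterate θ̂ σ p ≡ σ
  θ̂-period = iterate-map-period θL {p} (λ { (i , j) → trans (iterate-θL p i j) (cong (_, j) (sucMod-period {p′} i)) })

  ∈-iterate : ∀ k {i j} {σ : Vec (Label p t) n} → (i , j) ∈ σ → (iterate sucMod i k , j) ∈ iterate θ̂ σ k
  ∈-iterate zero    l∈σ = l∈σ
  ∈-iterate (suc k) l∈σ = ∈-iterate k (∈-map⁺ θL l∈σ)

  -- The number of rotations that take sign `i` to sign 0, kept below `p` so that it can index an
  -- orbit sum; for sign 0 it is 0 rather than `p`.
  opposite : Fin p → Fin p
  opposite zero    = zero
  opposite (suc i) = Fin.fromℕ< (ℕ.s≤s (ℕ.m∸n≤m p′ (toℕ i)))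

  sucMod-opposite : ∀ i → iterate sucMod i (toℕ (opposite i)) ≡ zero
  sucMod-opposite zero = refl
  sucMod-opposite (suc i) =
    trans (cong (iterate sucMod (suc i)) (Fin.toℕ-fromℕ< (ℕ.s≤s (ℕ.m∸n≤m p′ (toℕ i))))) (sucMod-to-zero (suc i))

  θ̂-opposite : ∀ i (σ : Vec (Label p t) n) → iterate θ̂ (iterate θ̂ σ (toℕ (opposite i))) (toℕ i) ≡ σ
  θ̂-opposite zero    σ = refl
  θ̂-opposite (suc i) σ = begin
    iterate θ̂ (iterate θ̂ σ (toℕ (opposite (suc i)))) (suc (toℕ i)) ≡⟨ iterate-+ θ̂ (toℕ (opposite (suc i))) _ σ ⟩
    iterate θ̂ σ (toℕ (opposite (suc i)) ℕ.+ suc (toℕ i))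
      ≡⟨ cong (λ k → iterate θ̂ σ (k ℕ.+ suc (toℕ i))) (Fin.toℕ-fromℕ< (ℕ.s≤s (ℕ.m∸n≤m p′ (toℕ i)))) ⟩
    iterate θ̂ σ (p ∸ suc (toℕ i) ℕ.+ suc (toℕ i))  ≡⟨ cong (iterate θ̂ σ) (ℕ.m∸n+n≡m (ℕ.<⇒≤ (Fin.toℕ<n (Fin.suc i)))) ⟩
    iterate θ̂ σ p                                  ≡⟨ θ̂-period σ ⟩
    σ ∎
    where open ≡-Reasoning

  hit : Vec (Label p t) n → Fin t → Bool
  hit σ j = does ((zero , j) ∈? σ)

  hit⁻ : (σ : Vec (Label p t) n) (j : Fin t) → hit σ j ≡ true → (zero , j) ∈ σ
  hit⁻ σ j eq with (zero , j) ∈? σ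
  ... | yes l∈σ = l∈σ

  orbit-hit : Vec (Label p t) n → Fin t → Fin p → Bool
  orbit-hit σ j k = hit (iterate θ̂ σ (toℕ k)) j

  -- The `k`-th translate contains sign 0 exactly if `σ` contains sign `- k` modulo `p`. Hence this
  -- is the number of distinct signs with which magnitude `j` occurs in `σ`.
  hits : Vec (Label p t) n → Fin t → ℕ
  hits σ j = count (orbit-hit σ j)

  hits-pos : ∀ {i j} (σ : Vec (Label p t) n) → (i , j) ∈ σ → 0 ℕ.< hits σ j
  hits-pos {i = i} {j} σ l∈σ = count-pos (orbit-hit σ j) (opposite i) (dec-true ((zero , j) ∈? _)
    (subst (λ i′ → (i′ , j) ∈ iterate θ̂ σ (toℕ (opposite i))) (sucMod-opposite i) (∈-iterate (toℕ (opposite i)) l∈σ)))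

  -- If all translates contain sign 0 at magnitude `j`, then rotating the translate by `opposite i`
  -- back to `σ` takes that sign to `i`, for every `i`.
  hits-<⊎Full : (σ : Vec (Label p t) n) (j : Fin t) → hits σ j ℕ.< p ⊎ Full σ
  hits-<⊎Full σ j = Sum.map₂ (λ all → j , λ i →
    subst₂ (λ i′ τ → (i′ , j) ∈ τ) (sucMod-from-zero i) (θ̂-opposite i σ)
      (∈-iterate (toℕ i) (hit⁻ _ j (all (opposite i))))) (count-<⊎all (orbit-hit σ j))

  -- The orbit is the same up to a cyclic shift. The count is rewritten as an integer sum so that
  -- `orbit-shift` applies.
  hits-θ̂ : (σ : Vec (Label p t) n) (j : Fin t) → hits (θ̂ σ) j ≡ hits σ j
  hits-θ̂ σ j = ℤ.+-injective (trans (count-sum (orbit-hit (θ̂ σ) j))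
    (trans eq (sym (count-sum (orbit-hit σ j)))))
    where
    f : ℕ → ℤ
    f k = indicator (hit (iterate θ̂ (θ̂ σ) k) j)
    g : ℕ → ℤ
    g k = indicator (hit (iterate θ̂ σ k) j)
    eq : sum {p} (f ∘ toℕ) ≡ sum {p} (g ∘ toℕ)
    eq = ℤ.i-j≡0⇒i≡j _ _ (trans (sym (sum-sub p (f ∘ toℕ) (g ∘ toℕ)))
           (orbit-shift θ̂ (λ τ → indicator (hit τ j)) σ (θ̂-period σ)))

  hits-iterate : ∀ k (σ : Vec (Label p t) n) j → hits (iterate θ̂ σ k) j ≡ hits σ j
  hits-iterate zero    σ j = refl
  hits-iterate (suc k) σ j = trans (hits-iterate k (θ̂ σ) j) (hits-θ̂ σ j)

  Swap-∈ : ∀ {x : X} {σ τ : Vec X n} → Swap σ τ → x ∈ σ → x ∈ τ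
  Swap-∈ here      (here e)          = there (here e)
  Swap-∈ here      (there (here e))  = here e
  Swap-∈ here      (there (there m)) = there (there m)
  Swap-∈ (there s) (here e)          = here e
  Swap-∈ (there s) (there m)         = there (Swap-∈ s m)

  hit-swap : {σ τ : Vec (Label p t) n} → Swap σ τ → ∀ j → hit σ j ≡ hit τ j
  hit-swap {σ = σ} {τ} s j =
    does-⇔ (mk⇔ (Swap-∈ s) (Swap-∈ (Swap-sym s))) ((zero , j) ∈? σ) ((zero , j) ∈? τ)

  hits-swap : {σ τ : Vec (Label p t) n} → Swap σ τ → ∀ j → hits σ j ≡ hits τ j
  hits-swap s j = count-cong {p} (λ k → hit-swap (Swap-iterate θL (toℕ k) s) j)

  -- Bézout's identity for `p` and `c`. Its two cases differ in the side that carries the extra 1,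
  -- and give the inverse `- y` or `y`.
  unit-inverse : ∀ {c} → Unit p c → ∃ λ u → ∀ {Q} → u ℤ.* + c ≈[ Q ] 1ℤ
  unit-inverse {c} (0<c , c<p) =
    invert (Coprimality.coprime-Bézout (Coprimality.prime⇒coprime p-prime {{ℕ.>-nonZero 0<c}} c<p))
    where
    open ≡-Reasoning
    cast : ∀ {a b c d} → 1 ℕ.+ a ℕ.* b ≡ c ℕ.* d → 1ℤ + + a ℤ.* + b ≡ + c ℤ.* + d
    cast {a} {b} {c} {d} eq = begin
      1ℤ + + a ℤ.* + b  ≡⟨ cong (_+_ 1ℤ) (ℤ.pos-* a b) ⟨
      + (1 ℕ.+ a ℕ.* b) ≡⟨ cong +_ eq ⟩
      + (c ℕ.* d)       ≡⟨ ℤ.pos-* c d ⟩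
      + c ℤ.* + d ∎
    invert : Bézout.Identity 1 p c → ∃ λ u → ∀ {Q} → u ℤ.* + c ≈[ Q ] 1ℤ
    invert (Bézout.+- x y eq) = - + y , congruent (ℤ∣.divides (- + x) (begin
      - + y ℤ.* + c - 1ℤ     ≡⟨ rearrange (+ y) (+ c) ⟩
      - (1ℤ + + y ℤ.* + c)   ≡⟨ cong -_ (cast {y} {c} {x} {p} eq) ⟩
      - (+ x ℤ.* + p)        ≡⟨ ℤ.neg-distribˡ-* (+ x) (+ p) ⟩
      - + x ℤ.* + p ∎))
      where
      rearrange : ∀ y c → - y ℤ.* c - 1ℤ ≡ - (1ℤ + y ℤ.* c)
      rearrange = solve-∀
    invert (Bézout.-+ x y eq) = + y , congruent (ℤ∣.divides (+ x) (begin
      + y ℤ.* + c - 1ℤ            ≡⟨ cong (λ z → z - 1ℤ) (cast {x} {p} {y} {c} eq) ⟨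
      (1ℤ + + x ℤ.* + p) - 1ℤ     ≡⟨ rearrange (+ x ℤ.* + p) ⟩
      + x ℤ.* + p ∎))
      where
      rearrange : ∀ a → (1ℤ + a) - 1ℤ ≡ a
      rearrange = solve-∀

  unit? : ∀ c → Dec (Unit p c)
  unit? c = (0 ℕ.<? c) ×-dec (c ℕ.<? p)

  divide : ∀ {c} → Dec (Unit p c) → ℤ → ℤ → ℤ
  divide (yes u) b r = proj₁ (unit-inverse u) ℤ.* b
  divide (no _)  b r = r

  -- b j / c j modulo p for the first j for which c j is between 0 and p
  quotient : ∀ {m} → (Fin m → ℕ) → (Fin m → ℤ) → ℤ
  quotient {zero}  c b = 0ℤ
  quotient {suc m} c b = divide (unit? (c zero)) (b zero) (quotient (c ∘ suc) (b ∘ suc))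

  quotient-cong : ∀ {m} {c c′ : Fin m → ℕ} (b b′ : Fin m → ℤ) → c ≗ c′ → b ≗ b′ → quotient c b ≡ quotient c′ b′
  quotient-cong {zero}  b b′ c≗ b≗ = refl
  quotient-cong {suc m} {c′ = c′} b b′ c≗ b≗ rewrite c≗ zero =
    cong₂ (divide (unit? (c′ zero))) (b≗ zero) (quotient-cong (b ∘ suc) (b′ ∘ suc) (c≗ ∘ suc) (b≗ ∘ suc))

  -- The index at which the division takes place depends on `c` alone, so the quotient is additive
  -- in the numerators.
  quotient-sum : ∀ {m} (c : Fin m → ℕ) l (b : Fin l → Fin m → ℤ) →
    sum {l} (λ k → quotient c (b k)) ≡ quotient c (λ j → sum {l} (λ k → b k j))
  quotient-sum {zero}  c l b = sum-zero l (λ _ → refl)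
  quotient-sum {suc m} c l b with unit? (c zero)
  ... | yes u = sym (*-distribˡ-sum {l} (proj₁ (unit-inverse u)) (λ k → b k zero))
  ... | no  _ = quotient-sum (c ∘ suc) l (λ k → b k ∘ suc)

  quotient-self : ∀ {m Q} (c : Fin m → ℕ) j → Unit p (c j) → quotient c (λ i → + c i) ≈[ Q ] 1ℤ
  quotient-self {suc m} c j u with unit? (c zero)
  ... | yes u′ = proj₂ (unit-inverse u′)
  quotient-self c zero    u | no ¬u = contradiction u ¬u
  quotient-self c (suc j) u | no _  = quotient-self (c ∘ suc) j u

  -- Weights with sum 1 on the orbit of a tuple that is not full: if c of its p translates contain sign 0
  -- at the chosen magnitude, then these have weight 1 / c and the others 0.
  χ : Vec (Label p t) n → ℤ
  χ σ = quotient (hits σ) (indicator ∘ hit σ)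

  χ-swap : {σ τ : Vec (Label p t) n} → Swap σ τ → χ σ ≡ χ τ
  χ-swap {σ = σ} {τ} s = quotient-cong (indicator ∘ hit σ) (indicator ∘ hit τ) (hits-swap s) (cong indicator ∘ hit-swap s)

  -- All translates have the same `hits` and therefore the same chosen magnitude and denominator.
  -- Their numerators add up to that denominator.
  χ-norm : (σ : Vec (Label p t) (suc n)) → sum {p} (λ k → χ (iterate θ̂ σ (toℕ k))) ≈[ Full σ ] 1ℤ
  -- The magnitude of the first label occurs in `σ`, so unless `σ` is full its `hits` is a unit and
  -- a denominator exists.
  χ-norm σ@((i , j) ∷ _) with hits-<⊎Full σ j
  ... | inj₂ full = exceptional full
  ... | inj₁ <p = ≈-trans (≈-reflexive (begin
    sum {p} (λ k → χ (iterate θ̂ σ (toℕ k)))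
      ≡⟨ sum-cong-≗ {p} (λ k → quotient-cong (hit-at k) (hit-at k) (hits-iterate (toℕ k) σ) (λ _ → refl)) ⟩
    sum {p} (λ k → quotient (hits σ) (hit-at k))
      ≡⟨ quotient-sum (hits σ) p hit-at ⟩
    quotient (hits σ) (λ j → sum {p} (λ k → hit-at k j))
      ≡⟨ quotient-cong (λ j → sum {p} (λ k → hit-at k j)) (λ j → + hits σ j) (λ _ → refl) (λ j → sym (count-sum (orbit-hit σ j))) ⟩
    quotient (hits σ) (λ j → + hits σ j) ∎))
    (quotient-self (hits σ) j (hits-pos σ (here refl) , <p))
    where
    open ≡-Reasoning
    hit-at : Fin p → Fin t → ℤ
    hit-at k = indicator ∘ hit (iterate θ̂ σ (toℕ k))

  -- After `θ̂`, another `p′` rotations complete the period and lead back to `σ`.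
  Full-θ̂ : {σ : Vec (Label p t) n} → Full (θ̂ σ) → Full σ
  Full-θ̂ {σ = σ} (j , all) = j , λ i → subst₂ (λ i′ τ → (i′ , j) ∈ τ) (sucMod-period i) (θ̂-period σ)
    (∈-iterate p′ {σ = θ̂ σ} (all (sucMod i)))

  -- The contracting homotopy of the periodic resolution given by the weights χ.
  𝕊 : ℕ → (Vec (Label p t) n → ℤ) → Vec (Label p t) n → ℤ
  𝕊 0 f σ = χ σ ℤ.* f σ
  𝕊 1 f σ = - sum {p} (λ k → χ (iterate θ̂ σ (toℕ k)) ℤ.* sum {toℕ k} (λ i → f (iterate θ̂ σ (toℕ i))))
  𝕊 (suc (suc m)) = 𝕊 m

  𝕊-alternating : ∀ m {f : Vec (Label p t) n → ℤ} → Alternating f → Alternating (𝕊 m f)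
  𝕊-alternating 0 alt = *-alternating χ-swap alt
  𝕊-alternating 1 {f} alt = neg-alternating (sum-alternating p (λ k →
    *-alternating (λ s → χ-swap (Swap-iterate θL (toℕ k) s))
      (sum-alternating (toℕ k) (λ i → iterate-alternating θL (toℕ i) alt))))
  𝕊-alternating (suc (suc m)) = 𝕊-alternating m

  invariant-iterate : (f : Vec (Label p t) n → ℤ) → (∀ σ → 𝔸 θ̂ 1 f σ ≈[ Full σ ] 0ℤ) →
    ∀ k σ → f (iterate θ̂ σ k) ≈[ Full σ ] f σ
  invariant-iterate f inv zero    σ = ≈-reflexive refl
  invariant-iterate f inv (suc k) σ = ≈-trans (≈-weaken Full-θ̂ (invariant-iterate f inv k (θ̂ σ))) step
    where
    rearrange : ∀ a b → a ≡ (a - b) + b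
    rearrange = solve-∀
    step : f (θ̂ σ) ≈[ Full σ ] f σ
    step = ≈-trans (≈-reflexive (rearrange (f (θ̂ σ)) (f σ)))
      (≈-trans (+-cong (inv σ) (≈-reflexive refl)) (≈-reflexive (ℤ.+-identityˡ (f σ))))

  -- This is exactness of the periodic complex away from full tuples. For `m` = 0, `f` is constant
  -- on orbits and factors out of a sum of weights with value 1.
  𝕊-section : ∀ m (f : Vec (Label p t) (suc n) → ℤ) →
    (∀ σ → 𝔸 θ̂ (suc m) f σ ≈[ Full σ ] 0ℤ) → ∀ σ → 𝔸 θ̂ m (𝕊 m f) σ ≈[ Full σ ] f σ
  𝕊-section 0 f inv σ = begin
    sum {p} (λ k → χ (iterate θ̂ σ (toℕ k)) ℤ.* f (iterate θ̂ σ (toℕ k)))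
      ≈⟨ sum-cong p (λ k → *-congˡ (χ (iterate θ̂ σ (toℕ k))) (invariant-iterate f inv (toℕ k) σ)) ⟩
    sum {p} (λ k → χ (iterate θ̂ σ (toℕ k)) ℤ.* f σ)
      ≡⟨ *-distribʳ-sum {p} (f σ) (λ k → χ (iterate θ̂ σ (toℕ k))) ⟨
    sum {p} (λ k → χ (iterate θ̂ σ (toℕ k))) ℤ.* f σ
      ≡⟨ ℤ.*-comm _ (f σ) ⟩
    f σ ℤ.* sum {p} (λ k → χ (iterate θ̂ σ (toℕ k)))
      ≈⟨ *-congˡ (f σ) (χ-norm σ) ⟩
    f σ ℤ.* 1ℤ ≡⟨ ℤ.*-identityʳ (f σ) ⟩
    f σ ∎
    where open ≈-Reasoning (Full σ)
  𝕊-section 1 f ker σ = begin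
    - sum {p} (λ k → shifted k) - - sum {p} (λ k → H (toℕ k))
      -- The total weight `N` of the orbit is inserted, after which summation by parts leaves a
      -- single end term, a multiple of the norm of `f`, which vanishes by hypothesis.
      ≡⟨ rearrange₁ (sum {p} shifted) (sum {p} (H ∘ toℕ)) (f σ ℤ.* N) ⟩
    f σ ℤ.* N - ((f σ ℤ.* N + sum {p} shifted) - sum {p} (H ∘ toℕ))
      ≡⟨ cong (λ z → f σ ℤ.* N - z) telescope ⟩
    f σ ℤ.* N - (χ (iterate θ̂ σ p) ℤ.* 𝔸 θ̂ 0 f σ)
      ≈⟨ sub-cong (*-congˡ (f σ) (≈-weaken Full-θ̂ (χ-norm (θ̂ σ)))) (*-congˡ (χ (iterate θ̂ σ p)) (ker σ)) ⟩
    f σ ℤ.* 1ℤ - (χ (iterate θ̂ σ p) ℤ.* 0ℤ)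
      ≡⟨ rearrange₂ (f σ) (χ (iterate θ̂ σ p)) ⟩
    f σ ∎
    where
    open ≈-Reasoning (Full σ)
    partial : ℕ → Vec (Label p t) _ → ℤ
    partial k τ = sum {k} (λ i → f (iterate θ̂ τ (toℕ i)))
    H : ℕ → ℤ
    H k = χ (iterate θ̂ σ k) ℤ.* partial k σ
    shifted : Fin p → ℤ
    shifted k = χ (iterate θ̂ (θ̂ σ) (toℕ k)) ℤ.* partial (toℕ k) (θ̂ σ)
    N : ℤ
    N = sum {p} (λ k → χ (iterate θ̂ (θ̂ σ) (toℕ k)))
    rearrange₁ : ∀ a b c → - a - - b ≡ c - ((c + a) - b)
    rearrange₁ = solve-∀
    rearrange₂ : ∀ a b → a ℤ.* 1ℤ - (b ℤ.* 0ℤ) ≡ a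
    rearrange₂ = solve-∀
    telescope : (f σ ℤ.* N + sum {p} shifted) - sum {p} (H ∘ toℕ) ≡ χ (iterate θ̂ σ p) ℤ.* 𝔸 θ̂ 0 f σ
    telescope = sum-by-parts p (f σ) (λ k → χ (iterate θ̂ σ k)) (λ k → partial k σ) (λ k → partial k (θ̂ σ))
                  refl (λ k → refl)
  𝕊-section (suc (suc m)) = 𝕊-section m

-- The cochains `φ` obtained from freeness.

module LabelCochains {p′ : ℕ} (p-prime : Prime (suc p′)) {t : ℕ} where

  open Labels p-prime {t} hiding (p)
  private p = suc p′
  open DecMembership {A = Label p t} (≡-dec Fin._≟_ Fin._≟_) using (_∈?_)

  φ : ∀ n → Vec (Label p t) n → ℤ
  φ zero    = λ _ → 1ℤ
  φ (suc n) = 𝕊 n (δ (φ n))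

  φ-alternating : ∀ n → Alternating (φ n)
  φ-alternating zero    .swap ()
  φ-alternating zero    .stutter ()
  φ-alternating (suc n) = 𝕊-alternating n (δ-alternating (φ-alternating n))

  mutual

    φ-section : ∀ n (σ : Vec (Label p t) (suc n)) → 𝔸 θ̂ n (φ (suc n)) σ ≈[ Full σ ] δ (φ n) σ
    φ-section n = 𝕊-section n (δ (φ n)) (𝔸-δφ n)

    -- In the lowest degree `δ (φ 0)` is the constant 1, which is invariant. Above it, `𝔸` commutes
    -- with `δ` and turns `φ (suc n)` into a coboundary.
    𝔸-δφ : ∀ n (σ : Vec (Label p t) (suc n)) → 𝔸 θ̂ (suc n) (δ (φ n)) σ ≈[ Full σ ] 0ℤ
    𝔸-δφ zero    (x ∷ []) = ≈-reflexive refl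
    𝔸-δφ (suc n) σ = begin
      -- `𝔸` has period two in its index, so the operator with index `suc (suc n)` is the one that
      -- `φ-section` inverts.
      𝔸 θ̂ n (δ (φ (suc n))) σ   ≡⟨ δ-𝔸 θL n (φ (suc n)) σ ⟨
      δ (𝔸 θ̂ n (φ (suc n))) σ
        ≈⟨ δ-≈cong σ (λ τ τ⊆σ → ≈-weaken (λ (j , all) → j , λ i → τ⊆σ (all i)) (φ-section n τ)) ⟩
      δ (δ (φ n)) σ             ≡⟨ δ∘δ (φ n) σ ⟩
      0ℤ ∎
      where open ≈-Reasoning (Full σ)

  -- t * p′ + 1 labels either repeat a label or use all p signs of some magnitude.
  δφ-vanishes : (σ : Vec (Label p t) (suc (t * p′))) → δ (φ (t * p′)) σ ≈[ Full σ ] 0ℤ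
  δφ-vanishes σ with Fin.any? (λ j → Fin.all? (λ i → (i , j) ∈? σ))
  ... | yes full = exceptional full
  ... | no ¬full =
    let k , l , k<l , eq = Fin.pigeonhole (ℕ.n<1+n (t * p′)) slot
    in ≈-reflexive (alternating-repeat (δ-alternating (φ-alternating (t * p′))) σ k<l (slot-injective k l eq))
    where
    missing : ∀ j → ∃ λ i → ¬ ((i , j) ∈ σ)
    missing j = Fin.¬∀⟶∃¬ p _ (λ i → (i , j) ∈? σ) (λ all → ¬full (j , all))
    present : ∀ k → proj₁ (missing (proj₂ (lookup σ k))) ≢ proj₁ (lookup σ k)
    present k eq = proj₂ (missing j) (subst (λ i → (i , j) ∈ σ) (sym eq) (∈-lookup k σ))
      where
      j : Fin t
      j = proj₂ (lookup σ k)
    -- A label goes to its magnitude paired with its sign, renumbered among the `p′` signs other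
    -- than one missing at that magnitude.
    slot : Fin (suc (t * p′)) → Fin (t * p′)
    slot k = Fin.combine (proj₂ (lookup σ k)) (Fin.punchOut (present k))
    punchOut-cancel : ∀ {j j′ : Fin t} {i i′ : Fin p} (ne : proj₁ (missing j) ≢ i) (ne′ : proj₁ (missing j′) ≢ i′) →
      j ≡ j′ → Fin.punchOut ne ≡ Fin.punchOut ne′ → i ≡ i′
    punchOut-cancel ne ne′ refl eq = Fin.punchOut-injective ne ne′ eq
    slot-injective : ∀ k l → slot k ≡ slot l → lookup σ k ≡ lookup σ l
    slot-injective k l eq =
      let eqj , eqi = Fin.combine-injective (proj₂ (lookup σ k)) _ (proj₂ (lookup σ l)) _ eq
      in cong₂ _,_ (punchOut-cancel (present k) (present l) eqj eqi) eqj

-- Chains in powers of the star, as functionals on cochains.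

module Stars (p′ m′ : ℕ) where

  private
    p = suc p′
    m = suc m′
    Point : ℕ → Set
    Point = Pt p m

  open Modulo p

  θ̄ : Vec (Point d) n → Vec (Point d) n
  θ̄ = map θᵈ

  θ-period : (r : R p m) → iterate θ r p ≡ r
  θ-period r = trans (iterate-θ p r) (lemma r)
    where
    rotate : ℕ → R p m → R p m
    rotate k origin    = origin
    rotate k (ray i j) = ray (iterate sucMod i k) j
    iterate-θ : ∀ k r → iterate θ r k ≡ rotate k r
    iterate-θ zero    origin    = refl
    iterate-θ zero    (ray i j) = refl
    iterate-θ (suc k) origin    = iterate-θ k origin
    iterate-θ (suc k) (ray i j) = iterate-θ k (ray (sucMod i) j)
    lemma : ∀ r → rotate p r ≡ r
    lemma origin    = refl
    lemma (ray i j) = cong (λ i → ray i j) (sucMod-period {p′} i)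

  θ̄-period : (σ : Vec (Point d) n) → iterate θ̄ σ p ≡ σ
  θ̄-period = iterate-map-period θᵈ {p} (iterate-map-period θ {p} θ-period)

  -- These are the ends of the edges of the ray of sign 0; the other rays are reached through the
  -- rotations in `𝔸`.
  lower upper : Fin m → Point d → Point (suc d)
  lower a x = lowerPt zero a ∷ x
  upper a x = ray zero a ∷ x

  bottom top : Point d → Point (suc d)
  bottom x = origin ∷ x
  top    x = ray zero (fromℕ m′) ∷ x

  -- f evaluated on the product of a simplex with the path from 0 to the end of the ray of sign 0.
  rayPrism : (Vec (Point (suc d)) (suc n) → ℤ) → Vec (Point d) n → ℤ
  rayPrism f σ = sum {m} (λ a → prism (lower a) (upper a) f σ)

  rayPrism-sub : (f g : Vec (Point (suc d)) (suc n) → ℤ) → ∀ σ →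
    rayPrism (λ τ → f τ - g τ) σ ≡ rayPrism f σ - rayPrism g σ
  rayPrism-sub f g σ = trans
    (sum-cong-≗ {m} (λ a → prism-sub (lower a) (upper a) f g σ))
    (sum-sub m (λ a → prism (lower a) (upper a) f σ) (λ a → prism (lower a) (upper a) g σ))

  -- The upper end of each edge of the ray is the lower end of the next, so only the far end and 0
  -- survive the sum of the homotopy formulas.
  rayPrism-δ : (f : Vec (Point (suc d)) (suc n) → ℤ) → ∀ σ →
    rayPrism (δ f) σ ≡ (f (map top σ) - f (map bottom σ)) - δ (rayPrism f) σ
  rayPrism-δ f σ = begin
    rayPrism (δ f) σ
      ≡⟨ sum-cong-≗ {m} (λ a → prism-δ (lower a) (upper a) f σ) ⟩
    sum {m} (λ a → (f (map (upper a) σ) - f (map (lower a) σ)) - δ (prism (lower a) (upper a) f) σ)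
      ≡⟨ sum-sub m (λ a → f (map (upper a) σ) - f (map (lower a) σ)) (λ a → δ (prism (lower a) (upper a) f) σ) ⟩
    sum {m} (λ a → f (map (upper a) σ) - f (map (lower a) σ)) - sum {m} (λ a → δ (prism (lower a) (upper a) f) σ)
      ≡⟨ cong₂ _-_ (trans (sum-cong-≗ {m} steps) (sum-telescope m H))
                   (sym (δ-sum {m = m} (λ a → prism (lower a) (upper a) f) σ)) ⟩
    (f (map top σ) - f (map bottom σ)) - δ (rayPrism f) σ ∎
    where
    open ≡-Reasoning
    H : Fin (suc m) → ℤ
    H zero    = f (map bottom σ)
    H (suc a) = f (map (upper a) σ)
    steps : ∀ a → f (map (upper a) σ) - f (map (lower a) σ) ≡ H (suc a) - H (inject₁ a)
    steps zero    = refl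
    steps (suc a) = refl

  -- Evaluation on a d-chain of R^d whose boundary modulo p lies in ∂R^d.
  D : ∀ d → (Vec (Point d) (suc d) → ℤ) → ℤ
  D zero    f = f ([] ∷ [])
  D (suc d) f = D d (rayPrism (𝔸 θ̄ d f))

  -- Kuhn simplices and the supports of the chains.

  Cell : ℕ → Set
  Cell = Vec (Fin p × Fin m)

  corner : Cell d → Vec Bool d → Point d
  corner = zipWith λ (i , a) b → if b then ray i a else lowerPt i a

  _⊑_ : Vec Bool d → Vec Bool d → Set
  _⊑_ = Pointwise Bool._≤_

  ⊑-refl : {b : Vec Bool d} → b ⊑ b
  ⊑-refl = Pointwise.refl b≤b

  -- Kuhn simplices as increasing sequences of corners of one cube; W restricts the vertices.
  data Chain (W : Point d → Set) (c : Cell d) : ∀ {n} → Vec Bool d → Vec (Point d) n → Set where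
    []   : ∀ {b} → Chain W c b []
    step : ∀ {n b b′ x} {xs : Vec (Point d) n} →
      b ⊑ b′ → x ≡ corner c b′ → W x → Chain W c b′ xs → Chain W c b (x ∷ xs)

  Simplex : (Point d → Set) → Vec (Point d) n → Set
  Simplex W σ = ∃₂ λ c b → Chain W c b σ

  Anywhere : Point d → Set
  Anywhere _ = ⊤

  private variable
    Q : Set

  chain-lower : ∀ {W : Point d → Set} {W₁ : Point (suc d) → Set} a → (∀ {x} → W x → W₁ (lower a x)) →
    ∀ {c b} {σ : Vec (Point d) n} → Chain W c b σ →
    Chain W₁ ((zero , a) ∷ c) (false ∷ b) (map (lower a) σ)
  chain-lower a lowerW [] = []
  chain-lower a lowerW (step b⊑b′ refl w ch) = step (b≤b ∷ b⊑b′) refl (lowerW w) (chain-lower a lowerW ch)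

  chain-upper : ∀ {W : Point d → Set} {W₁ : Point (suc d) → Set} a → (∀ {x} → W x → W₁ (upper a x)) →
    ∀ {c b} {σ : Vec (Point d) n} → Chain W c b σ →
    Chain W₁ ((zero , a) ∷ c) (true ∷ b) (map (upper a) σ)
  chain-upper a upperW [] = []
  chain-upper a upperW (step b⊑b′ refl w ch) = step (b≤b ∷ b⊑b′) refl (upperW w) (chain-upper a upperW ch)

  -- A prism over a Kuhn simplex consists of Kuhn simplices: the new coordinate switches once from
  -- `false` to `true`, at a vertex where the old coordinates stay put.
  prism-cong : ∀ {W : Point d → Set} {W₁ : Point (suc d) → Set} a →
    (∀ {x} → W x → W₁ (lower a x)) → (∀ {x} → W x → W₁ (upper a x)) →
    ∀ {c b} {σ : Vec (Point d) n} → Chain W c b σ → {f g : Vec (Point (suc d)) (suc n) → ℤ} →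
    (∀ τ → Chain W₁ ((zero , a) ∷ c) (false ∷ b) τ → f τ ≈[ Q ] g τ) →
    prism (lower a) (upper a) f σ ≈[ Q ] prism (lower a) (upper a) g σ
  prism-cong a lowerW upperW [] eq = ≈-reflexive refl
  prism-cong a lowerW upperW (step {x = x} b⊑b′ refl w ch) eq = sub-cong
    (eq _ (step (b≤b ∷ b⊑b′) refl (lowerW w) (step (f≤t ∷ ⊑-refl) refl (upperW w) (chain-upper a upperW ch))))
    (prism-cong a lowerW upperW ch (λ τ ch′ → eq (lower a x ∷ τ) (step (b≤b ∷ b⊑b′) refl (lowerW w) ch′)))

  rayPrism-cong : ∀ {W : Point d → Set} {W₁ : Point (suc d) → Set} →
    (∀ a {x} → W x → W₁ (lower a x)) → (∀ a {x} → W x → W₁ (upper a x)) →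
    {f g : Vec (Point (suc d)) (suc n) → ℤ} → (∀ τ → Simplex W₁ τ → f τ ≈[ Q ] g τ) →
    ∀ σ → Simplex W σ → rayPrism f σ ≈[ Q ] rayPrism g σ
  rayPrism-cong lowerW upperW eq σ (c , b , ch) = sum-cong m (λ a →
    prism-cong a (lowerW a) (upperW a) ch (λ τ ch′ → eq τ (_ , _ , ch′)))

  simplex-θ̄ : ∀ {W : Point d → Set} → (∀ {x} → W x → W (θᵈ x)) → {σ : Vec (Point d) n} → Simplex W σ → Simplex W (θ̄ σ)
  simplex-θ̄ {W = W} θW (c , b , ch) = rotate c , b , chain ch
    where
    rotate : Cell d → Cell d
    rotate = map λ (i , a) → sucMod i , a
    θ-corner : ∀ {d} (c : Cell d) b → θᵈ (corner c b) ≡ corner (rotate c) b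
    θ-corner []            []          = refl
    θ-corner ((i , a) ∷ c) (true ∷ b)  = cong (_ ∷_) (θ-corner c b)
    θ-corner ((i , zero) ∷ c) (false ∷ b) = cong (_ ∷_) (θ-corner c b)
    θ-corner ((i , suc a) ∷ c) (false ∷ b) = cong (_ ∷_) (θ-corner c b)
    chain : ∀ {n b} {σ : Vec _ n} → Chain W c b σ → Chain W (rotate c) b (θ̄ σ)
    chain [] = []
    chain (step b⊑b′ refl w ch) = step b⊑b′ (θ-corner c _) (θW w) (chain ch)

  simplex-iterate : ∀ {W : Point d → Set} → (∀ {x} → W x → W (θᵈ x)) → ∀ k {σ : Vec (Point d) n} →
    Simplex W σ → Simplex W (iterate θ̄ σ k)
  simplex-iterate θW zero    s = s
  simplex-iterate θW (suc k) s = simplex-iterate θW k (simplex-θ̄ θW s)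

  -- Products with a ray and rotations preserve Kuhn simplices, so the chain behind `D` is supported
  -- on them.
  D-cong : ∀ d {f g : Vec (Point d) (suc d) → ℤ} →
    (∀ σ → Simplex Anywhere σ → f σ ≈[ Q ] g σ) → D d f ≈[ Q ] D d g
  D-cong zero    eq = eq _ ([] , [] , step [] refl tt [])
  D-cong (suc d) {f} {g} eq = D-cong d (rayPrism-cong (λ _ _ → tt) (λ _ _ → tt) (λ τ s →
    𝔸-cong θ̄ d {f} {g} τ (λ k → eq _ (simplex-iterate (λ _ → tt) k s))))

  D-≗ : ∀ d {f g : Vec (Point d) (suc d) → ℤ} → f ≗ g → D d f ≈[ Q ] D d g
  D-≗ d eq = D-cong d (λ σ _ → ≈-reflexive (eq σ))

  rayPrism-≗ : {f g : Vec (Point (suc d)) (suc n) → ℤ} → f ≗ g → ∀ σ → rayPrism f σ ≡ rayPrism g σ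
  rayPrism-≗ eq σ = sum-cong-≗ {m} (λ a → go a eq σ)
    where
    go : ∀ {n} a {f g : Vec (Point _) (suc n) → ℤ} → f ≗ g → prism (lower a) (upper a) f ≗ prism (lower a) (upper a) g
    go a eq []       = refl
    go a eq (x ∷ xs) = cong₂ _-_ (eq _) (go a (eq ∘ (lower a x ∷_)) xs)

  D-sub : ∀ d (f g : Vec (Point d) (suc d) → ℤ) → D d (λ σ → f σ - g σ) ≈[ Q ] D d f - D d g
  D-sub zero    f g = ≈-reflexive refl
  D-sub (suc d) f g = ≈-trans
    (D-≗ d (λ σ → trans (rayPrism-≗ (𝔸-sub θ̄ d f g) σ) (rayPrism-sub (𝔸 θ̄ d f) (𝔸 θ̄ d g) σ)))
    (D-sub d (rayPrism (𝔸 θ̄ d f)) (rayPrism (𝔸 θ̄ d g)))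

  D-zero : ∀ d {f : Vec (Point d) (suc d) → ℤ} → (∀ σ → Simplex Anywhere σ → f σ ≈[ Q ] 0ℤ) → D d f ≈[ Q ] 0ℤ
  D-zero d {f} eq = begin
    D d f               ≈⟨ D-cong d eq ⟩
    D d (λ _ → 0ℤ)      ≈⟨ D-sub d (λ _ → 0ℤ) (λ _ → 0ℤ) ⟩
    D d (λ _ → 0ℤ) - D d (λ _ → 0ℤ)  ≡⟨ ℤ.+-inverseʳ (D d (λ _ → 0ℤ)) ⟩
    0ℤ ∎
    where open ≈-Reasoning _

  rayPrism-zero : {f : Vec (Point (suc d)) (suc n) → ℤ} → (∀ τ → f τ ≡ 0ℤ) → ∀ σ → rayPrism f σ ≡ 0ℤ
  rayPrism-zero {f = f} eq σ = trans (rayPrism-≗ (λ τ → trans (eq τ) (sym (ℤ.+-inverseʳ 0ℤ))) σ)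
    (trans (rayPrism-sub (λ _ → 0ℤ) (λ _ → 0ℤ) σ) (ℤ.+-inverseʳ (rayPrism (λ _ → 0ℤ) σ)))

  -- In dimension 0 the rotations fix the only point, so the norm is multiplication by `p`. In
  -- higher dimension the chain is itself an image of `𝔸`, and two successive `𝔸` compose to zero.
  D∘𝔸 : ∀ d (f : Vec (Point d) (suc d) → ℤ) → D d (𝔸 θ̄ d f) ≈[ Q ] 0ℤ
  D∘𝔸 zero f = ≈-trans
    (≈-reflexive (trans (sum-cong-≗ {p} (λ k → cong f (unique (iterate θ̄ ([] ∷ []) (toℕ k))))) (sum-const p _)))
    (p*≈0 (f ([] ∷ [])))
    where
    unique : (σ : Vec (Point 0) 1) → σ ≡ [] ∷ []
    unique ([] ∷ []) = refl
  D∘𝔸 (suc d) f = D-zero d (λ σ _ → ≈-reflexive (rayPrism-zero (𝔸∘𝔸 θ̄ θ̄-period d f) σ))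

  -- A d-chain of ∂R^(d+1) such that 𝔸 of it is the boundary of D (suc d).
  B : ∀ d → (Vec (Point (suc d)) (suc d) → ℤ) → ℤ
  B d f = D d (f ∘ map top) - D d (δ (rayPrism f))

  -- The boundary of a ray times the chain of `D d` is the part collected in `B d` minus the copy
  -- over 0.
  D∘rayPrism-δ : ∀ d (f : Vec (Point (suc d)) (suc d) → ℤ) → D d (rayPrism (δ f)) ≈[ Q ] B d f - D d (f ∘ map bottom)
  D∘rayPrism-δ d f = begin
    D d (rayPrism (δ f))   ≈⟨ D-≗ d (rayPrism-δ f) ⟩
    D d (λ σ → (f (map top σ) - f (map bottom σ)) - δ (rayPrism f) σ)
      ≈⟨ D-sub d (λ σ → f (map top σ) - f (map bottom σ)) (δ (rayPrism f)) ⟩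
    D d (λ σ → f (map top σ) - f (map bottom σ)) - D d (δ (rayPrism f))
      ≈⟨ sub-cong (D-sub d (f ∘ map top) (f ∘ map bottom)) (≈-reflexive refl) ⟩
    (D d (f ∘ map top) - D d (f ∘ map bottom)) - D d (δ (rayPrism f))
      ≡⟨ rearrange (D d (f ∘ map top)) (D d (f ∘ map bottom)) (D d (δ (rayPrism f))) ⟩
    B d f - D d (f ∘ map bottom) ∎
    where
    open ≈-Reasoning _
    rearrange : ∀ a b c → (a - b) - c ≡ (a - c) - b
    rearrange = solve-∀

  -- Rotation fixes 0 and so commutes with `bottom`; the copy over 0 therefore contributes `D d`
  -- after `𝔸`, which vanishes.
  D-δ : ∀ d (g : Vec (Point (suc d)) (suc d) → ℤ) → D (suc d) (δ g) ≈[ Q ] B d (𝔸 θ̄ d g)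
  D-δ d g = begin
    D d (rayPrism (𝔸 θ̄ d (δ g)))   ≈⟨ D-≗ d (rayPrism-≗ (λ σ → sym (δ-𝔸 θᵈ d g σ))) ⟩
    D d (rayPrism (δ (𝔸 θ̄ d g)))   ≈⟨ D∘rayPrism-δ d (𝔸 θ̄ d g) ⟩
    B d (𝔸 θ̄ d g) - D d (𝔸 θ̄ d g ∘ map bottom)
      ≈⟨ sub-cong (≈-reflexive {a = B d (𝔸 θ̄ d g)} refl) (≈-trans (D-≗ d bottom-natural) (D∘𝔸 d (g ∘ map bottom))) ⟩
    B d (𝔸 θ̄ d g) - 0ℤ             ≡⟨ ℤ.+-identityʳ (B d (𝔸 θ̄ d g)) ⟩
    B d (𝔸 θ̄ d g) ∎
    where
    open ≈-Reasoning _
    bottom-natural : ∀ σ → 𝔸 θ̄ d g (map bottom σ) ≡ 𝔸 θ̄ d (g ∘ map bottom) σ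
    bottom-natural σ = sym (𝔸-natural θ̄ θ̄ (map bottom) g d σ (λ k → iterate-natural (map bottom)
      (λ τ → trans (sym (Vec.map-∘ bottom θᵈ τ)) (Vec.map-∘ θᵈ bottom τ)) k σ))

  Boundary-θ : {x : Point d} → Boundary x → Boundary (θᵈ x)
  Boundary-θ {x = x} (ℓ , max) = ℓ , subst IsMax (sym (Vec.lookup-map ℓ θ x)) (IsMax-θ (lookup x ℓ) max)
    where
    IsMax-θ : (r : R p m) → IsMax r → IsMax (θ r)
    IsMax-θ (ray i j) max = max

  Boundary-top : {x : Point d} → Boundary (top x)
  Boundary-top = zero , cong suc (Fin.toℕ-fromℕ m′)

  Boundary-∷ : ∀ r {x : Point d} → Boundary x → Boundary (r ∷ x)
  Boundary-∷ r (ℓ , max) = suc ℓ , max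

  -- The far end of the ray lies in the boundary. The other part is a ray times the boundary of the
  -- chain of `D d`, which by `D-δ` consists of rotated simplices of the preceding `B` and so by
  -- induction lies in the boundary.
  B-cong : ∀ d {f g : Vec (Point (suc d)) (suc d) → ℤ} →
    (∀ σ → Simplex Boundary σ → f σ ≈[ Q ] g σ) → B d f ≈[ Q ] B d g
  B-cong d {f} {g} eq = sub-cong
    (D-cong d (λ { σ (c , b , ch) → eq (map top σ) (_ , _ , chain-upper (fromℕ m′) (λ _ → Boundary-top) ch) }))
    (side d eq)
    where
    side : ∀ d {f g : Vec (Point (suc d)) (suc d) → ℤ} → (∀ σ → Simplex Boundary σ → f σ ≈[ Q ] g σ) →
      D d (δ (rayPrism f)) ≈[ Q ] D d (δ (rayPrism g))
    -- The boundary of a point is the empty simplex, where `prism` is 0.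
    side zero    eq = ≈-reflexive refl
    side (suc d) {f} {g} eq = ≈-trans (D-δ d (rayPrism f))
      (≈-trans (B-cong d (λ σ s → 𝔸-cong θ̄ d {rayPrism f} {rayPrism g} σ (λ k →
          rayPrism-cong (λ _ → Boundary-∷ _) (λ _ → Boundary-∷ _) eq _ (simplex-iterate (λ {x} → Boundary-θ {x = x}) k s))))
        (≈-sym (D-δ d (rayPrism g))))

-- Sorting coordinates by a key.

punchIn-<ᵇ-above : ∀ (q : Fin (suc d)) x {k} → toℕ q ≤ k → (toℕ (Fin.punchIn q x) <ᵇ suc k) ≡ (toℕ x <ᵇ k)
punchIn-<ᵇ-above zero    x       q≤k         = refl
punchIn-<ᵇ-above (suc q) zero    (ℕ.s≤s q≤k) = refl
punchIn-<ᵇ-above (suc q) (suc x) (ℕ.s≤s q≤k) = punchIn-<ᵇ-above q x q≤k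

-- `punchIn` moves only positions from `q` on, and these fail the comparison before and after the
-- move.
punchIn-<ᵇ-below : ∀ (q : Fin (suc d)) x {k} → k ≤ toℕ q → (toℕ (Fin.punchIn q x) <ᵇ k) ≡ (toℕ x <ᵇ k)
punchIn-<ᵇ-below q       x       {zero}  k≤q         = refl
punchIn-<ᵇ-below (suc q) zero    {suc k} (ℕ.s≤s k≤q) = refl
punchIn-<ᵇ-below (suc q) (suc x) {suc k} (ℕ.s≤s k≤q) = punchIn-<ᵇ-below q x k≤q

-- A sorting of the coordinates with ties broken in some way: `below i` is the number of keys less
-- than `i`, and their coordinates occupy the first places.
record Ranking {d} (key : Fin d → ℕ) : Set where
  field
    rank  : Permutation′ d
    below : ℕ → Fin (suc d)
    mono  : ∀ {i j} → i ≤ j → toℕ (below i) ≤ toℕ (below j)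
    rank< : ∀ i ℓ → (toℕ (rank ⟨$⟩ʳ ℓ) <ᵇ toℕ (below i)) ≡ (key ℓ <ᵇ i)

-- Insertion sort: coordinate 0 is put in front of the coordinates whose keys are at least its own,
-- and `below` grows by one beyond its key.
ranking : ∀ {d} (key : Fin d → ℕ) → Ranking key
ranking {zero}  key = record
  { rank = Permutation.id ; below = λ _ → zero ; mono = λ _ → ℕ.z≤n ; rank< = λ _ () }
ranking {suc d} key = record
  { rank = Permutation.insert zero q rank
  ; below = λ i → below′ (key zero ℕ.<? i)
  ; mono = mono′
  ; rank< = λ { i zero → rank<-zero i ; i (suc ℓ) → trans
      (cong (λ z → toℕ z <ᵇ toℕ (below′ (key zero ℕ.<? i))) (Permutation.insert-punchIn zero q rank ℓ))
      (trans (rank<-suc i ℓ) (rank< i ℓ)) }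
  }
  where
  open Ranking (ranking (key ∘ suc))
  q : Fin (suc d)
  q = below (key zero)
  below′ : ∀ {i} → Dec (key zero ℕ.< i) → Fin (suc (suc d))
  below′ {i} (yes _) = suc (below i)
  below′ {i} (no _)  = inject₁ (below i)
  mono′ : ∀ {i j} → i ≤ j → toℕ (below′ (key zero ℕ.<? i)) ≤ toℕ (below′ (key zero ℕ.<? j))
  mono′ {i} {j} i≤j with key zero ℕ.<? i | key zero ℕ.<? j
  ... | yes _  | yes _ = ℕ.s≤s (mono i≤j)
  ... | yes <i | no ≮j = contradiction (ℕ.<-≤-trans <i i≤j) ≮j
  ... | no _   | yes _ rewrite Fin.toℕ-inject₁ (below i) = ℕ.m≤n⇒m≤1+n (mono i≤j)
  ... | no _   | no _ rewrite Fin.toℕ-inject₁ (below i) | Fin.toℕ-inject₁ (below j) = mono i≤j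
  rank<-zero : ∀ i → (toℕ q <ᵇ toℕ (below′ (key zero ℕ.<? i))) ≡ (key zero <ᵇ i)
  rank<-zero i with key zero ℕ.<? i
  ... | yes <i = trans (dec-true (toℕ q ℕ.<? suc (toℕ (below i))) (ℕ.s≤s (mono (ℕ.<⇒≤ <i)))) (sym (dec-true (key zero ℕ.<? i) <i))
  ... | no ≮i rewrite Fin.toℕ-inject₁ (below i) =
    trans (dec-false (toℕ q ℕ.<? toℕ (below i)) (ℕ.≤⇒≯ (mono (ℕ.≮⇒≥ ≮i)))) (sym (dec-false (key zero ℕ.<? i) ≮i))
  rank<-suc : ∀ i ℓ → (toℕ (Fin.punchIn q (rank ⟨$⟩ʳ ℓ)) <ᵇ toℕ (below′ (key zero ℕ.<? i)))
                      ≡ (toℕ (rank ⟨$⟩ʳ ℓ) <ᵇ toℕ (below i))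
  rank<-suc i ℓ with key zero ℕ.<? i
  ... | yes <i = punchIn-<ᵇ-above q (rank ⟨$⟩ʳ ℓ) (mono (ℕ.<⇒≤ <i))
  ... | no ≮i rewrite Fin.toℕ-inject₁ (below i) = punchIn-<ᵇ-below q (rank ⟨$⟩ʳ ℓ) (mono (ℕ.≮⇒≥ ≮i))

-- From increasing corners to faces of Kuhn's triangulation.

module Kuhn (p′ m′ : ℕ) where

  open Stars p′ m′
  private
    p = suc p′
    m = suc m′

  -- The key of a coordinate is the number of vertices of the chain that precede its increase.
  chain-keys : ∀ {W : Pt p m d → Set} {c b} {σ : Vec (Pt p m d) n} → Chain W c b σ →
    ∃ λ (key : Fin d → ℕ) → ∀ {x} → x ∈ σ →
      ∃₂ λ i b′ → b ⊑ b′ × x ≡ corner c b′ × (∀ ℓ → lookup b′ ℓ ≡ (key ℓ <ᵇ i))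
  -- With this start, a coordinate that is never increased gets the length of the chain as its key,
  -- which no position exceeds.
  chain-keys [] = (λ _ → 0) , λ ()
  chain-keys {d = d} {c = c} {b} {x ∷ xs} (step {b′ = b′} b⊑b′ x≡ _ ch) = key , position
    where
    key′ : Fin d → ℕ
    key′ = proj₁ (chain-keys ch)
    key : Fin d → ℕ
    key ℓ = if lookup b′ ℓ then 0 else suc (key′ ℓ)
    first : ∀ ℓ → lookup b′ ℓ ≡ (key ℓ <ᵇ 1)
    first ℓ with lookup b′ ℓ
    ... | true  = refl
    ... | false = refl
    later : ∀ {i b″} → b′ ⊑ b″ → (∀ ℓ → lookup b″ ℓ ≡ (key′ ℓ <ᵇ i)) → ∀ ℓ → lookup b″ ℓ ≡ (key ℓ <ᵇ suc i)
    later b′⊑b″ eq ℓ with lookup b′ ℓ | Pointwise.lookup b′⊑b″ ℓ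
    ... | false | _    = eq ℓ
    ... | true  | true≤ = true-max true≤
      where
      true-max : ∀ {x} → true Bool.≤ x → x ≡ true
      true-max b≤b = refl
    position : ∀ {y} → y ∈ (x ∷ xs) → ∃₂ λ i b″ → b ⊑ b″ × y ≡ corner c b″ × (∀ ℓ → lookup b″ ℓ ≡ (key ℓ <ᵇ i))
    -- A position counts the vertices up to and including the given one, so key 0 is passed already
    -- at the first vertex.
    position (here refl) = 1 , b′ , b⊑b′ , x≡ , first
    position (there y∈xs) =
      let i , b″ , b′⊑b″ , y≡ , eq = proj₂ (chain-keys ch) y∈xs
      in suc i , b″ , Pointwise.trans Bool.≤-trans b⊑b′ b′⊑b″ , y≡ , later b′⊑b″ eq

  corner-tabulate : (c : Cell d) (b : Vec Bool d) → corner c b ≡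
    tabulate (λ ℓ → if lookup b ℓ then ray (proj₁ (lookup c ℓ)) (proj₂ (lookup c ℓ))
                                  else lowerPt (proj₁ (lookup c ℓ)) (proj₂ (lookup c ℓ)))
  corner-tabulate []      []      = refl
  corner-tabulate (a ∷ c) (b ∷ bs) = cong (_ ∷_) (corner-tabulate c bs)

  simplex-kuhn : ∀ {W : Pt p m d → Set} {σ : Vec (Pt p m d) n} → Simplex W σ →
    ∀ {k} (x : Fin k → Pt p m d) → (∀ i → x i ∈ σ) → IsKuhnFace x
  simplex-kuhn {d = d} (c , b , ch) x x∈σ =
    -- `kuhnVertex` reads the place of a coordinate through the inverse permutation, hence the flip.
    proj₁ ∘ lookup c , proj₂ ∘ lookup c , Permutation.flip rank , below ∘ index , λ i →
      let _ , b′ , _ , x≡ , eq = proj₂ (chain-keys ch) (x∈σ i)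
      in trans x≡ (trans (corner-tabulate c b′) (Vec.tabulate-cong (λ ℓ →
           cong (if_then ray (proj₁ (lookup c ℓ)) (proj₂ (lookup c ℓ)) else lowerPt (proj₁ (lookup c ℓ)) (proj₂ (lookup c ℓ)))
             (trans (eq ℓ) (sym (rank< (index i) ℓ))))))
    where
    open Ranking (ranking (proj₁ (chain-keys ch)))
    index : Fin _ → ℕ
    index i = proj₁ (proj₂ (chain-keys ch) (x∈σ i))

-- The index of a labeling.

module Index {p′ : ℕ} (p-prime : Prime (suc p′)) (m′ : ℕ) {t : ℕ} where

  private
    p = suc p′
    m = suc m′
    Point : ℕ → Set
    Point = Pt p m

  open Labels p-prime {t} hiding (p)
  open LabelCochains p-prime {t}
  open Stars p′ m′

  private variable
    Q : Set

  Equivariant : (Point d → Label p t) → Set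
  Equivariant lab = ∀ x → Boundary x → lab (θᵈ x) ≡ θL (lab x)

  FullImplies : Set → (Point d → Label p t) → Set
  FullImplies Q lab = ∀ {n} (σ : Vec (Point _) n) → Simplex Anywhere σ → Full (map lab σ) → Q

  simplex-anywhere : ∀ {W : Point d → Set} {σ : Vec (Point d) n} → Simplex W σ → Simplex Anywhere σ
  simplex-anywhere (c , b , ch) = c , b , weaken ch
    where
    weaken : ∀ {W : Point _ → Set} {n b} {σ : Vec _ n} → Chain W c b σ → Chain Anywhere c b σ
    weaken []                = []
    weaken (step b≤ x≡ _ ch) = step b≤ x≡ tt (weaken ch)

  labels-equivariant : {lab : Point d → Label p t} → Equivariant lab → ∀ {σ : Vec (Point d) n} →
    Simplex Boundary σ → map lab (θ̄ σ) ≡ θ̂ (map lab σ)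
  labels-equivariant {lab = lab} equi (c , b , ch) = go ch
    where
    go : ∀ {n b} {σ : Vec (Point _) n} → Chain Boundary c b σ → map lab (θ̄ σ) ≡ θ̂ (map lab σ)
    go []               = refl
    go (step _ _ bd ch) = cong₂ _∷_ (equi _ bd) (go ch)

  labels-iterate : {lab : Point d → Label p t} → Equivariant lab → ∀ k {σ : Vec (Point d) n} →
    Simplex Boundary σ → map lab (iterate θ̄ σ k) ≡ iterate θ̂ (map lab σ) k
  labels-iterate equi zero    s = refl
  labels-iterate equi (suc k) s = trans (labels-iterate equi k (simplex-θ̄ (λ {x} → Boundary-θ {x = x}) s))
    (cong (λ τ → iterate θ̂ τ k) (labels-equivariant equi s))

  -- The coboundary moves the evaluation to the boundary of the star power. There the labeling is
  -- equivariant, so `𝔸` can be applied to labels, where it turns `φ (suc d)` into `δ (φ d)`.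
  index-step : ∀ d (lab : Point (suc d) → Label p t) → Equivariant lab → FullImplies Q lab →
    D (suc d) (δ (φ (suc d)) ∘ map lab) ≈[ Q ] D d (δ (φ d) ∘ map (lab ∘ bottom))
  index-step {Q} d lab equi full = begin
    D (suc d) (δ (φ (suc d)) ∘ map lab)     ≈⟨ D-≗ (suc d) (λ σ → sym (δ-map lab (φ (suc d)) σ)) ⟩
    D (suc d) (δ (φ (suc d) ∘ map lab))     ≈⟨ D-δ d (φ (suc d) ∘ map lab) ⟩
    B d (𝔸 θ̄ d (φ (suc d) ∘ map lab))       ≈⟨ B-cong d on-boundary ⟩
    -- As `f` is a cocycle, its value on the chain of `B d` equals its value on the copy of the
    -- chain of `D d` over 0.
    B d f                                   ≡⟨ rearrange (B d f) (D d (f ∘ map bottom)) ⟩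
    (B d f - D d (f ∘ map bottom)) + D d (f ∘ map bottom)
      ≈⟨ +-cong (D∘rayPrism-δ d f) (≈-reflexive {a = D d (f ∘ map bottom)} refl) ⟨
    D d (rayPrism (δ f)) + D d (f ∘ map bottom)
      ≈⟨ +-cong (D-zero d (λ σ _ → ≈-reflexive (rayPrism-zero δf≡0 σ)))
                (D-≗ d (λ σ → cong (δ (φ d)) (sym (Vec.map-∘ lab bottom σ)))) ⟩
    0ℤ + D d (δ (φ d) ∘ map (lab ∘ bottom)) ≡⟨ ℤ.+-identityˡ _ ⟩
    D d (δ (φ d) ∘ map (lab ∘ bottom)) ∎
    where
    open ≈-Reasoning Q
    f : Vec (Point (suc d)) (suc d) → ℤ
    f = δ (φ d) ∘ map lab
    on-boundary : ∀ σ → Simplex Boundary σ → 𝔸 θ̄ d (φ (suc d) ∘ map lab) σ ≈[ Q ] f σ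
    on-boundary σ s = ≈-trans
      (≈-reflexive (𝔸-natural θ̄ θ̂ (map lab) (φ (suc d)) d σ (λ k → labels-iterate equi k s)))
      (≈-weaken (full σ (simplex-anywhere s)) (φ-section d (map lab σ)))
    δf≡0 : ∀ τ → δ f τ ≡ 0ℤ
    δf≡0 τ = trans (δ-map lab (δ (φ d)) τ) (δ∘δ (φ d) (map lab τ))
    rearrange : ∀ a b → a ≡ (a - b) + b
    rearrange = solve-∀

  -- Each step restricts the labeling to the points with first coordinate 0, until a single point is
  -- left, on which `δ (φ 0)` is 1.
  index-one : ∀ d (lab : Point d → Label p t) → Equivariant lab → FullImplies Q lab →
    D d (δ (φ d) ∘ map lab) ≈[ Q ] 1ℤ
  index-one zero    lab equi full = ≈-reflexive refl
  index-one (suc d) lab equi full = ≈-trans (index-step d lab equi full)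
    (index-one d (lab ∘ bottom) (λ x bd → equi (bottom x) (Boundary-∷ origin bd)) λ { σ (c , b , ch) fullσ →
      -- `bottom` agrees with `lower zero`, so the copy of a Kuhn simplex over 0 is a Kuhn simplex.
      full (map bottom σ) (_ , _ , chain-lower zero (λ _ → tt) ch) (subst Full (Vec.map-∘ lab bottom σ) fullσ) })

  -- The index is 1 in every dimension, but in dimension `t * p′` the cochain vanishes on all tuples
  -- that are not full. Since `p` does not divide 1, an exception must have occurred.
  full-implied : (lab : Point (t * p′) → Label p t) → Equivariant lab → FullImplies Q lab → Q
  full-implied {Q} lab equi full = conclude (≈-trans (≈-sym (index-one (t * p′) lab equi full))
    (D-zero (t * p′) (λ σ s → ≈-weaken (full σ s) (δφ-vanishes (map lab σ)))))
    where
    conclude : 1ℤ ≈[ Q ] 0ℤ → Q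
    conclude (exceptional q) = q
    conclude (congruent p∣1) =
      contradiction (subst Prime (∣1⇒≡1 (ℤ∣.∣⇒∣ᵤ p∣1)) p-prime) ¬prime[1]

mainTheorem12 : (p m t : ℕ) → Prime p → 1 ≤ m → 1 ≤ t →
    (lab : Pt p m (t * (p ∸ 1)) → Label p t) →
    (∀ x → Boundary x → lab (θᵈ x) ≡ θL (lab x)) →
    Σ (Fin p → Pt p m (t * (p ∸ 1))) λ x → Σ (Fin t) λ j →
    IsKuhnFace x × (∀ i → lab (x i) ≡ (i , j))
mainTheorem12 zero     m        t p-prime 1≤m 1≤t lab equi = contradiction p-prime ¬prime[0]
mainTheorem12 (suc p′) (suc m′) t p-prime 1≤m 1≤t lab equi =
  -- The conclusion itself serves as `Q`. A simplex with full labels has, for each sign, a vertex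
  -- with that sign at magnitude `j`, and the chosen vertices span a face.
  full-implied lab equi λ { σ s (j , all) →
    let vertex = λ i → find (Any.map⁻ (all i))
    in proj₁ ∘ vertex , j , simplex-kuhn s (proj₁ ∘ vertex) (proj₁ ∘ proj₂ ∘ vertex) , λ i → sym (proj₂ (proj₂ (vertex i))) }
  where
  open Index p-prime m′ {t}
  open Kuhn p′ m′
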